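{- Let $A$ be a finite alphabet and let $S\subset A^*$ be a uniformly recurrent tree set. Then every basis $X$ of the free group on $A$ such that $X\subset S$ is tame.
   Context: Words and sets. $A$ is a finite nonempty alphabet, $A^*$ the free monoid of finite words over $A$, $A^+$ the set of nonempty words. A set $S$ of words is factorial if it contains all factors of its elements. A factorial set $S$ is right-extendable if for every $w\in S$ there is a letter $a$ with $wa\in S$, and biextendable if for every $w\in S$ there are letters $a,b$ with $awb\in S$. A set $S$ is uniformly recurrent if it is (nonempty) factorial and right-extendable and for every $u\in S$ there is $n\ge 1$ such that $u$ is a factor of every word of $S$ of length $n$. Tree sets. For a factorial set $S$ and $w\in S$, let $L(w)=\{a\in A\mid aw\in S\}$, $R(w)=\{a\in A\mid wa\in S\}$, $E(w)=\{(a,b)\in A\times A\mid awb\in S\}$. The extension graph $G(w)$ is the undirected graph whose vertex set is the disjoint union of $L(w)$ and $R(w)$ and whose edges are the pairs $(a,b)\in E(w)$ (joining $a\in L(w)$ to $b\in R(w)$). $S$ is a tree set if it is factorial, biextendable, and for every $w\in S$ (including the empty word) the graph $G(w)$ is a tree, i.e. connected and acyclic. Tame bases. $A^*$ is viewed inside the free group on $A$. An automorphism $\alpha$ of the free group on $A$ is positive if $\alpha(a)\in A^+$ for every $a\in A$. For $a,b\in A$ with $a\neq b$, let $\alpha_{a,b}$ be the automorphism with $a\mapsto ab$ and $c\mapsto c$ for every letter $c\ne a$, and let $\tilde\alpha_{a,b}$ be the automorphism with $a\mapsto ba$ and $c\mapsto c$ for every letter $c\neq a$. A positive automorphism is tame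 if it belongs to the submonoid (under composition) generated by the permutations of $A$ and all the $\alpha_{a,b}$, $\tilde\alpha_{a,b}$ ($a\ne b$). A basis $X\subset A^+$ of the free group on $A$ is tame if $X=\alpha(A)$ for some tame automorphism $\alpha$. -}

module Defs where

open import Algebra.Bundles using (Group; Monoid)
open import Algebra.Morphism.Structures using (module GroupMorphisms)
import Algebra.Morphism.Construct.Composition as Comp
import Algebra.Morphism.Construct.Identity as Id
open import Data.List.Base
  using (List; []; _∷_; [_]; _++_; length; map; foldr; reverse)
open import Data.List.Properties
  using (++-assoc; ++-identityʳ; map-++; reverse-++; unfold-reverse)
open import Data.List.Relation.Binary.Infix.Heterogeneous using (Infix)
open import Data.List.Relation.Unary.All using (All)
open import Data.List.Relation.Unary.Linked using (Linked)
open import Data.List.Relation.Unary.Unique.Propositional using (Unique)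
open import Data.Nat.Base using (_≤_; _≥_)
open import Data.Product.Base using (∃; _×_; _,_; proj₁)
open import Data.Sign.Base using (Sign; opposite) renaming (+ to pos; - to neg)
open import Data.Sign.Properties using (opposite-involutive)
open import Data.Sum.Base using (_⊎_; inj₁; inj₂)
open import Function.Base using (id; _∘_)
open import Function.Bundles using (_↔_; Inverse)
open import Level using (Level; _⊔_; suc)
open import Relation.Binary.Core using (Rel)
open import Relation.Binary.Construct.Closure.Equivalence as Eq using (EqClosure)
open import Relation.Binary.Construct.Closure.ReflexiveTransitive as Star using (Star)
open import Relation.Binary.Construct.Closure.Symmetric using (fwd)
open import Relation.Binary.PropositionalEquality
  using (_≡_; _≢_; refl; sym; trans; cong; cong₂; subst₂)
open import Relation.Nullary.Negation using (¬_)
open import Relation.Unary using (Pred; Satisfiable; U; _≐_)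

private
  variable
    a c ℓ e p s v : Level

module _ {A : Set a} where

  Factor : Rel (List A) a
  Factor = Infix _≡_

  Factorial : Pred (List A) s → Set (a ⊔ s)
  Factorial S = ∀ {u w} → Factor u w → S w → S u

  RightExtendable : Pred (List A) s → Set (a ⊔ s)
  RightExtendable S = ∀ {w} → S w → ∃ λ x → S (w ++ [ x ])

  Biextendable : Pred (List A) s → Set (a ⊔ s)
  Biextendable S = ∀ {w} → S w → ∃ λ x → ∃ λ y → S (x ∷ w ++ [ y ])

  record IsUniformlyRecurrent (S : Pred (List A) s) : Set (a ⊔ s) where
    field
      nonempty        : Satisfiable S
      factorial       : Factorial S
      rightExtendable : RightExtendable S
      recurrent       : ∀ {u} → S u →
        ∃ λ n → n ≥ 1 × (∀ {w} → S w → length w ≡ n → Factor u w)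

-- The vertices are the elements of V satisfying IsVertex.  A predicate is
-- used rather than a Σ-type so that different proofs of membership do not
-- yield different vertices.
record Graph (V : Set v) p e : Set (v ⊔ suc (p ⊔ e)) where
  field
    IsVertex : Pred V p
    Adjacent : Rel V e

module _ {V : Set v} (G : Graph V p e) where
  open Graph G

  Connected : Set (v ⊔ p ⊔ e)
  Connected = ∀ {x y} → IsVertex x → IsVertex y → Star Adjacent x y

  -- A cycle x, x₁, …, xₖ, x with k ≥ 2 and x, x₁, …, xₖ distinct.
  record Cycle : Set (v ⊔ e) where
    field
      start    : V
      others   : List V
      closed   : Linked Adjacent (start ∷ others ++ [ start ])
      distinct : Unique (start ∷ others)
      long     : 2 ≤ length others

  IsTree : Set (v ⊔ p ⊔ e)
  IsTree = Connected × ¬ Cycle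

module _ {A : Set a} (S : Pred (List A) s) where

  L R : List A → Pred A s
  L w x = S (x ∷ w)
  R w x = S (w ++ [ x ])

  E : List A → A → A → Set s
  E w x y = S (x ∷ w ++ [ y ])

  data ExtVertex (w : List A) : Pred (A ⊎ A) (a ⊔ s) where
    left  : ∀ {x} → L w x → ExtVertex w (inj₁ x)
    right : ∀ {y} → R w y → ExtVertex w (inj₂ y)

  -- For factorial S the end points of an edge are automatically vertices.
  data ExtAdjacent (w : List A) : Rel (A ⊎ A) (a ⊔ s) where
    left-right : ∀ {x y} → E w x y → ExtAdjacent w (inj₁ x) (inj₂ y)
    right-left : ∀ {x y} → E w x y → ExtAdjacent w (inj₂ y) (inj₁ x)

  extensionGraph : List A → Graph (A ⊎ A) (a ⊔ s) (a ⊔ s)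
  extensionGraph w = record
    { IsVertex = ExtVertex w
    ; Adjacent = ExtAdjacent w
    }

  record IsTreeSet : Set (a ⊔ s) where
    field
      factorial    : Factorial S
      biextendable : Biextendable S
      tree         : ∀ {w} → S w → IsTree (extensionGraph w)

-- The free group on A consists of signed words modulo insertion and deletion
-- of x x⁻¹ and x⁻¹ x.

module _ (A : Set a) where

  SignedWord : Set a
  SignedWord = List (A × Sign)

module _ {A : Set a} where

  data Cancel : Rel (SignedWord A) a where
    cancel : ∀ u x σ v →
      Cancel (u ++ (x , σ) ∷ (x , opposite σ) ∷ v) (u ++ v)

  flipSign : A × Sign → A × Sign
  flipSign (x , σ) = x , opposite σ

  invert : SignedWord A → SignedWord A
  invert = reverse ∘ map flipSign

  private
    infix 4 _~_
    _~_ : Rel (SignedWord A) a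
    _~_ = EqClosure Cancel

    ~-reflexive : ∀ {u v} → u ≡ v → u ~ v
    ~-reflexive refl = Eq.reflexive Cancel

    ++-congˡ : ∀ t {u v} → u ~ v → t ++ u ~ t ++ v
    ++-congˡ t = Eq.gmap (t ++_) step
      where
      step : ∀ {u v} → Cancel u v → Cancel (t ++ u) (t ++ v)
      step (cancel u x σ v) =
        subst₂ Cancel (++-assoc t u _) (++-assoc t u v) (cancel (t ++ u) x σ v)

    ++-congʳ : ∀ t {u v} → u ~ v → u ++ t ~ v ++ t
    ++-congʳ t = Eq.gmap (_++ t) step
      where
      step : ∀ {u v} → Cancel u v → Cancel (u ++ t) (v ++ t)
      step (cancel u x σ v) =
        subst₂ Cancel (sym (++-assoc u _ t)) (sym (++-assoc u v t))
          (cancel u x σ (v ++ t))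

    ++-cong : ∀ {u u′ v v′} → u ~ u′ → v ~ v′ → u ++ v ~ u′ ++ v′
    ++-cong {u′ = u′} {v = v} p q =
      Eq.transitive Cancel (++-congʳ v p) (++-congˡ u′ q)

    invert-++ : ∀ u v → invert (u ++ v) ≡ invert v ++ invert u
    invert-++ u v =
      trans (cong reverse (map-++ flipSign u v))
            (reverse-++ (map flipSign u) (map flipSign v))

    invert-∷ : ∀ x u → invert (x ∷ u) ≡ invert u ++ [ flipSign x ]
    invert-∷ x u = unfold-reverse (flipSign x) (map flipSign u)

    invert-involutive : ∀ u → invert (invert u) ≡ u
    invert-involutive [] = refl
    invert-involutive ((x , σ) ∷ u) =
      trans (cong invert (invert-∷ (x , σ) u))
      (trans (invert-++ (invert u) _)
             (cong₂ _∷_ (cong (x ,_) (opposite-involutive σ))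
                        (invert-involutive u)))

    invert-cong : ∀ {u v} → u ~ v → invert u ~ invert v
    invert-cong = Eq.gmap invert step
      where
      step : ∀ {u v} → Cancel u v → Cancel (invert u) (invert v)
      step (cancel u x σ v) =
        subst₂ Cancel (sym eq) (sym (invert-++ u v))
          (cancel (invert v) x (opposite (opposite σ)) (invert u))
        where
        eq : invert (u ++ (x , σ) ∷ (x , opposite σ) ∷ v) ≡
             invert v ++ (x , opposite (opposite σ))
               ∷ (x , opposite (opposite (opposite σ))) ∷ invert u
        eq rewrite opposite-involutive (opposite σ) =
          trans (invert-++ u _)
          (trans (cong (_++ invert u)
                   (trans (invert-++ ((x , σ) ∷ (x , opposite σ) ∷ []) v)
                          refl))
                 (++-assoc (invert v) _ (invert u)))

    inverseʳ : ∀ u → u ++ invert u ~ []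
    inverseʳ [] = Eq.reflexive Cancel
    inverseʳ ((x , σ) ∷ u) =
      Eq.transitive Cancel
        (~-reflexive (cong ((x , σ) ∷_)
          (trans (cong (u ++_) (invert-∷ (x , σ) u))
                 (sym (++-assoc u (invert u) _)))))
      (Eq.transitive Cancel
        (++-congˡ [ (x , σ) ] (++-congʳ [ (x , opposite σ) ] (inverseʳ u)))
        (Star.return (fwd (cancel [] x σ []))))

    inverseˡ : ∀ u → invert u ++ u ~ []
    inverseˡ u =
      Eq.transitive Cancel
        (~-reflexive (cong (invert u ++_) (sym (invert-involutive u))))
        (inverseʳ (invert u))

  freeGroupOn : Group a a
  freeGroupOn = record
    { Carrier = SignedWord A
    ; _≈_     = EqClosure Cancel
    ; _∙_     = _++_
    ; ε       = []
    ; _⁻¹     = invert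
    ; isGroup = record
      { isMonoid = record
        { isSemigroup = record
          { isMagma = record
            { isEquivalence = Eq.isEquivalence Cancel
            ; ∙-cong        = ++-cong
            }
          ; assoc = λ u v w → ~-reflexive (++-assoc u v w)
          }
        ; identity = (λ u → Eq.reflexive Cancel)
                   , (λ u → ~-reflexive (++-identityʳ u))
        }
      ; inverse = inverseˡ , inverseʳ
      ; ⁻¹-cong = invert-cong
      }
    }

freeGroup : (A : Set a) → Group a a
freeGroup A = freeGroupOn {A = A}

module _ {A : Set a} where

  -- The embedding of the free monoid A* into the free group on A.
  ι : List A → SignedWord A
  ι = map (_, pos)

  gen : A → SignedWord A
  gen x = ι [ x ]

module _ (G : Group c ℓ) where
  open Group G

  power : Carrier × Sign → Carrier
  power (x , pos) = x
  power (x , neg) = x ⁻¹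

  product : List (Carrier × Sign) → Carrier
  product = foldr _∙_ ε ∘ map power

  Cancelling : Rel (Carrier × Sign) ℓ
  Cancelling (x , σ) (y , τ) = x ≈ y × τ ≡ opposite σ

  Reduced : Pred (List (Carrier × Sign)) (c ⊔ ℓ)
  Reduced = Linked (λ x y → ¬ Cancelling x y)

  -- Y freely generates G: it generates G, and no nonempty reduced product
  -- of elements of Y and their inverses is trivial.
  record IsBasis (Y : Pred Carrier p) : Set (c ⊔ ℓ ⊔ p) where
    field
      generates : ∀ g → ∃ λ us → All (Y ∘ proj₁) us × product us ≈ g
      free      : ∀ us → All (Y ∘ proj₁) us → Reduced us →
                  product us ≈ ε → us ≡ []

  Image : {B : Set a} → (B → Carrier) → Pred B p → Pred Carrier (a ⊔ ℓ ⊔ p)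
  Image f P g = ∃ λ x → P x × g ≈ f x

module _ (G : Group c ℓ) where
  open Group G using (Carrier; _≈_; rawGroup)
    renaming (refl to ≈-refl; sym to ≈-sym; trans to ≈-trans)
  open GroupMorphisms rawGroup rawGroup

  record Automorphism : Set (c ⊔ ℓ) where
    field
      ⟦_⟧                : Carrier → Carrier
      isGroupIsomorphism : IsGroupIsomorphism ⟦_⟧

    open IsGroupIsomorphism isGroupIsomorphism public

  open Automorphism using (⟦_⟧; isGroupIsomorphism; ⟦⟧-cong)

  automorphismMonoid : Monoid (c ⊔ ℓ) (c ⊔ ℓ)
  automorphismMonoid = record
    { Carrier  = Automorphism
    ; _≈_      = λ α β → ∀ g → ⟦ α ⟧ g ≈ ⟦ β ⟧ g
    ; _∙_      = λ α β → record
      { ⟦_⟧                = ⟦ α ⟧ ∘ ⟦ β ⟧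
      ; isGroupIsomorphism =
          Comp.isGroupIsomorphism ≈-trans
            (isGroupIsomorphism β) (isGroupIsomorphism α)
      }
    ; ε        = record
      { ⟦_⟧                = id
      ; isGroupIsomorphism = Id.isGroupIsomorphism rawGroup ≈-refl
      }
    ; isMonoid = record
      { isSemigroup = record
        { isMagma = record
          { isEquivalence = record
            { refl  = λ _ → ≈-refl
            ; sym   = λ p g → ≈-sym (p g)
            ; trans = λ p q g → ≈-trans (p g) (q g)
            }
          ; ∙-cong = λ {α} {β} {γ} {δ} p q g →
              ≈-trans (p (⟦ γ ⟧ g)) (⟦⟧-cong β (q g))
          }
        ; assoc = λ _ _ _ _ → ≈-refl
        }
      ; identity = (λ _ _ → ≈-refl) , (λ _ _ → ≈-refl)
      }
    }

-- resp makes this a subset with respect to the setoid equality of M.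
data Submonoid (M : Monoid c ℓ) (P : Pred (Monoid.Carrier M) p) :
               Pred (Monoid.Carrier M) (c ⊔ ℓ ⊔ p) where
  generator : ∀ {x} → P x → Submonoid M P x
  unit      : Submonoid M P (Monoid.ε M)
  mult      : ∀ {x y} → Submonoid M P x → Submonoid M P y →
              Submonoid M P (Monoid._∙_ M x y)
  resp      : ∀ {x y} → Monoid._≈_ M x y → Submonoid M P x → Submonoid M P y

module _ {A : Set a} where
  open Group (freeGroup A) using (_≈_; _∙_)
  open Automorphism using (⟦_⟧)

  Positive : Pred (Automorphism (freeGroup A)) a
  Positive α = ∀ x → ∃ λ w → w ≢ [] × ⟦ α ⟧ (gen x) ≈ ι w

  -- An automorphism is determined by its values on letters, so each of the
  -- generators is described by these values; α[ x , y ] has x ↦ xy and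
  -- α′[ x , y ] (usually written α̃) has x ↦ yx.
  data Elementary (α : Automorphism (freeGroup A)) : Set a where
    permutation : (π : A ↔ A) →
      (∀ x → ⟦ α ⟧ (gen x) ≈ gen (Inverse.to π x)) → Elementary α
    α[_,_]      : ∀ x y → x ≢ y →
      ⟦ α ⟧ (gen x) ≈ gen x ∙ gen y →
      (∀ z → z ≢ x → ⟦ α ⟧ (gen z) ≈ gen z) → Elementary α
    α′[_,_]     : ∀ x y → x ≢ y →
      ⟦ α ⟧ (gen x) ≈ gen y ∙ gen x →
      (∀ z → z ≢ x → ⟦ α ⟧ (gen z) ≈ gen z) → Elementary α

  TameAutomorphism : Pred (Automorphism (freeGroup A)) a
  TameAutomorphism α =
    Positive α × Submonoid (automorphismMonoid (freeGroup A)) Elementary α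

  -- Sets of words are regarded as subsets of the free group through ι.
  IsFreeGroupBasis : Pred (List A) p → Set (a ⊔ p)
  IsFreeGroupBasis X = IsBasis (freeGroup A) (Image (freeGroup A) ι X)

  -- The last component says X = α(A), as subsets of the free group.
  IsTame : Pred (List A) p → Set (a ⊔ p)
  IsTame X = ∃ λ α → TameAutomorphism α ×
    Image (freeGroup A) ι X ≐ Image (freeGroup A) (⟦ α ⟧ ∘ gen) U

{-# OPTIONS --safe #-}

-- If x = yz with x, y ∈ X (or symmetrically x = zy), then replacing x by z
-- gives a shorter basis contained in S, and x is recovered by an elementary
-- automorphism.  So it suffices that a basis X ⊆ S which is a bifix code is
-- the alphabet.  In the Stallings graph of X two prefixes p, p′ are
-- identified when pq, p′q ∈ X for some q.  That it is already folded is where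
-- acyclicity enters: if a path in the bipartite graph of the factorisations
-- pq ∈ X has end points on the same side which begin (at the cut) with the
-- same letter, then so do all its vertices on that side.  As X generates the
-- free group, every letter labels a loop at the base point, hence lies in X.

module Submission where

open import Algebra.Bundles using (Group; Monoid)
import Algebra.Properties.Group as GroupProperties
open import Data.Fin.Base using (Fin; zero; suc)
import Data.Fin.Properties as Fin
open import Data.List.Base
  using ( List; []; _∷_; _++_; [_]; map; foldr; length; drop; reverse; _ʳ++_
        ; lookup; deduplicate; concatMap; allFin)
import Data.List.Membership.DecPropositional as DecMembership
open import Data.List.Membership.Propositional using (_∈_; lose)
open import Data.List.Membership.Propositional.Properties
  using ( ∈-deduplicate⁺; ∈-deduplicate⁻; ∈-concatMap⁺; ∈-concatMap⁻; ∈-allFin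
        ; ∈-lookup; ∈-map⁺)
open import Data.List.Properties
  using ( ++-assoc; ++-identityʳ; ++-identityʳ-unique; ++-identityˡ-unique; ++-ʳ++; ʳ++-defn
        ; map-++; map-∘; map-injective; length-map; length-++; length-++-≤ʳ
        ; unfold-reverse; reverse-injective; ≡-dec)
open import Data.List.Relation.Binary.Infix.Heterogeneous using (here; there; _++ⁱ_)
open import Data.List.Relation.Binary.Prefix.Heterogeneous using (Prefix; []; _∷_)
open import Data.List.Relation.Unary.All as All using (All; []; _∷_)
open import Data.List.Relation.Unary.All.Properties using (¬Any⇒All¬; map⁺; map⁻; ++⁺)
open import Data.List.Relation.Unary.AllPairs using ([]; _∷_)
open import Data.List.Relation.Unary.Any as Any using (here; there)
open import Data.List.Relation.Unary.Any.Properties using (lookup-index)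
open import Data.List.Relation.Unary.Linked as Linked using (Linked; []; [-]; _∷_)
import Data.List.Relation.Unary.Linked.Properties as Linked
open import Data.List.Relation.Unary.Unique.DecPropositional.Properties using (deduplicate-!)
open import Data.List.Relation.Unary.Unique.Propositional using (Unique)
open import Data.Nat.Base using (ℕ; zero; suc; _+_; _≤_; _<_; z≤n; s≤s)
open import Data.Nat.Induction using (<-wellFounded)
open import Data.Nat.Properties
  using (≤-refl; ≤-reflexive; ≤-trans; <⇒≤; +-comm; +-mono-≤; +-mono-<-≤; +-mono-≤-<; m<n+m)
open import Data.Product.Base using (∃; ∃₂; _×_; _,_; proj₁; proj₂; map₁)
import Data.Product.Properties as Product
open import Data.Sign.Base using (Sign; opposite) renaming (+ to pos; - to neg)
import Data.Sign.Properties as Sign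
open import Data.Sum.Base using (_⊎_; inj₁; inj₂)
import Data.Sum.Properties as Sum
import Data.Vec.Functional as Vector
open import Data.Vec.Functional using (Vector)
open import Defs
open import Function.Base using (_∘_; flip)
open import Function.Bundles using (_↔_; Inverse; mk↔ₛ′)
open import Function.Properties.Inverse using (↔⇒↣)
open import Induction.WellFounded using (Acc; acc)
open import Level using (Level; _⊔_)
import Relation.Binary.Construct.Closure.Equivalence as Eq
open import Relation.Binary.Construct.Closure.ReflexiveTransitive as Star
  using (Star; _◅_; _◅◅_)
open import Relation.Binary.Construct.Closure.Symmetric using (bwd)
open import Relation.Binary.Core using (Rel)
open import Relation.Binary.Definitions using (DecidableEquality)
open import Relation.Binary.PropositionalEquality
  using (_≡_; _≢_; refl; sym; trans; cong; cong₂; subst)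
  renaming (isEquivalence to ≡-isEquivalence)
import Relation.Binary.Reasoning.Setoid as SetoidReasoning
open import Relation.Nullary.Decidable using (map′; via-injection)
open import Relation.Nullary.Decidable.Core using (Dec; yes; no; ¬?; _×-dec_; _⊎-dec_)
open import Relation.Nullary.Negation using (¬_; contradiction)
open import Relation.Unary using (Pred; _⊆_; U)

-- Acyclicity of the extension graphs speaks about single letters on the two sides of a word `w`,
-- whereas foldedness concerns whole prefixes and suffixes of words of `X`. The bridge is a
-- convexity statement about contexts around an arbitrary `w`, used only for `w = []` but proved by
-- letting `w` grow. The roles of the two sides alternate in this induction, hence the parameter
-- `Side`. Its paths are required to have incomparable vertices two steps apart: this makes first
-- letters exist, and it survives the removal of a common first letter. For factorisations of words
-- of a bifix code, being incomparable amounts to being distinct, so cancelling backtracks suffices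
-- to obtain such paths. Foldedness is determinism in both directions: forwards convexity is applied
-- to completions, backwards to prefixes. A basis is given as a predicate, so a finite family has to
-- be extracted before the descent on total length can start.

private
  variable
    a b c i p q s t v ℓ : Level

-- Homomorphisms out of free groups

module _ {A : Set a} where

  infix 4 _~_
  _~_ : SignedWord A → SignedWord A → Set a
  _~_ = Group._≈_ (freeGroup A)

module Free {a} {A : Set a} = Group (freeGroup A)

module _ (G : Group c ℓ) where
  open Group G

  power-cong : ∀ {x y} σ → x ≈ y → power G (x , σ) ≈ power G (y , σ)
  power-cong pos = λ p → p
  power-cong neg = ⁻¹-cong

  power-opposite : ∀ x σ → power G (x , σ) ∙ power G (x , opposite σ) ≈ ε
  power-opposite x pos = inverseʳ x
  power-opposite x neg = inverseˡ x

module _ {I : Set i} (G : Group c ℓ) where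
  open Group G
  open SetoidReasoning setoid

  -- The homomorphism given by the universal property of the free group on `I`.
  extend : (I → Carrier) → SignedWord I → Carrier
  extend g w = product G (map (map₁ g) w)

  extend-cong : ∀ {g h} → (∀ k → g k ≈ h k) → ∀ w → extend g w ≈ extend h w
  extend-cong g≈h []            = Group.refl G
  extend-cong g≈h ((k , σ) ∷ w) = ∙-cong (power-cong G σ (g≈h k)) (extend-cong g≈h w)

  module _ (g : I → Carrier) where

    extend-++ : ∀ u v → extend g (u ++ v) ≈ extend g u ∙ extend g v
    extend-++ []            v = Group.sym G (identityˡ _)
    extend-++ ((k , σ) ∷ u) v =
      Group.trans G (∙-congˡ (extend-++ u v)) (Group.sym G (assoc _ _ _))

    extend-~ : ∀ {u v} → u ~ v → extend g u ≈ extend g v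
    extend-~ = Eq.gfold isEquivalence (extend g) step
      where
      step : ∀ {u v} → Cancel u v → extend g u ≈ extend g v
      step (cancel u x σ v) = begin
        extend g (u ++ (x , σ) ∷ (x , opposite σ) ∷ v)
          ≈⟨ extend-++ u _ ⟩
        extend g u ∙ (power G (g x , σ) ∙ (power G (g x , opposite σ) ∙ extend g v))
          ≈⟨ ∙-congˡ (Group.trans G (Group.sym G (assoc _ _ _))
               (Group.trans G (∙-congʳ (power-opposite G (g x) σ)) (identityˡ _))) ⟩
        extend g u ∙ extend g v
          ≈⟨ extend-++ u v ⟨
        extend g (u ++ v) ∎

    extend-invert : ∀ w → extend g (invert w) ≈ extend g w ⁻¹
    extend-invert w = GroupProperties.inverseˡ-unique G _ _ (begin
      extend g (invert w) ∙ extend g w ≈⟨ extend-++ (invert w) w ⟨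
      extend g (invert w ++ w)         ≈⟨ extend-~ (Free.inverseˡ w) ⟩
      ε                                ∎)

    extend-gen : ∀ k → extend g (gen k) ≈ g k
    extend-gen k = identityʳ (g k)

module _ {I : Set i} {J : Set b} (G : Group c ℓ) where
  open Group G
  open SetoidReasoning setoid

  extend-extend : ∀ (g : J → Carrier) (h : I → SignedWord J) w →
    extend G g (extend (freeGroup J) h w) ≈ extend G (extend G g ∘ h) w
  extend-extend g h []            = Group.refl G
  extend-extend g h ((k , σ) ∷ w) = Group.trans G
    (extend-++ G g (power (freeGroup J) (h k , σ)) _)
    (∙-cong (extend-power σ) (extend-extend g h w))
    where
    extend-power : ∀ σ → extend G g (power (freeGroup J) (h k , σ)) ≈
                         power G (extend G g (h k) , σ)
    extend-power pos = Group.refl G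
    extend-power neg = extend-invert G g (h k)

extend-gen-id : ∀ {I : Set i} (w : SignedWord I) → extend (freeGroup I) gen w ≡ w
extend-gen-id []              = refl
extend-gen-id ((k , pos) ∷ w) = cong ((k , pos) ∷_) (extend-gen-id w)
extend-gen-id ((k , neg) ∷ w) = cong ((k , neg) ∷_) (extend-gen-id w)

flipSign-involutive : ∀ {A : Set a} (x : A × Sign) → flipSign (flipSign x) ≡ x
flipSign-involutive (x , σ) = cong (x ,_) (Sign.opposite-involutive σ)

-- Normal forms of signed words

module NormalForm {A : Set a} (_≟_ : DecidableEquality A) where

  _≟±_ : DecidableEquality (A × Sign)
  _≟±_ = Product.≡-dec _≟_ Sign._≟_

  infixr 5 _▹_
  _▹_ : A × Sign → SignedWord A → SignedWord A
  x ▹ []      = [ x ]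
  x ▹ (y ∷ w) with y ≟± flipSign x
  ... | yes _ = w
  ... | no  _ = x ∷ y ∷ w

  normalise : SignedWord A → SignedWord A
  normalise = foldr _▹_ []

  IsNormal : SignedWord A → Set a
  IsNormal = Linked (λ x y → y ≢ flipSign x)

  ▹-isNormal : ∀ x {w} → IsNormal w → IsNormal (x ▹ w)
  ▹-isNormal x []  = [-]
  ▹-isNormal x {y ∷ w} n with y ≟± flipSign x
  ▹-isNormal x [-]     | yes _ = []
  ▹-isNormal x (_ ∷ n) | yes _ = n
  ... | no y≢x̄ = y≢x̄ ∷ n

  normalise-isNormal : ∀ w → IsNormal (normalise w)
  normalise-isNormal []      = []
  normalise-isNormal (x ∷ w) = ▹-isNormal x (normalise-isNormal w)

  ▹-∷ : ∀ x {w} → IsNormal (x ∷ w) → x ▹ w ≡ x ∷ w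
  ▹-∷ x [-] = refl
  ▹-∷ x {y ∷ w} (y≢x̄ ∷ _) with y ≟± flipSign x
  ... | yes y≡x̄ = contradiction y≡x̄ y≢x̄
  ... | no  _   = refl

  -- This makes `_▹_` an action of the free group on normal words (van der Waerden's argument),
  -- which is why `normalise` is invariant under `Cancel`.
  ▹-cancel : ∀ x {w} → IsNormal w → x ▹ flipSign x ▹ w ≡ w
  ▹-cancel x {[]} n with flipSign x ≟± flipSign x
  ... | yes _ = refl
  ... | no x̄≢ = contradiction refl x̄≢
  ▹-cancel x {y ∷ w} n with y ≟± flipSign (flipSign x)
  -- Here `y` is `x`: the inner operation deletes it, and the outer one restores it because the word
  -- was normal.
  ... | yes refl rewrite flipSign-involutive x = ▹-∷ x n
  ... | no _ with flipSign x ≟± flipSign x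
  ...   | yes _ = refl
  ...   | no x̄≢ = contradiction refl x̄≢

  normalise-~ : ∀ {u v} → u ~ v → normalise u ≡ normalise v
  normalise-~ = Eq.gfold ≡-isEquivalence normalise step
    where
    step : ∀ {u v} → Cancel u v → normalise u ≡ normalise v
    step (cancel []      x σ v) = ▹-cancel (x , σ) (normalise-isNormal v)
    step (cancel (y ∷ u) x σ v) = cong (y ▹_) (step (cancel u x σ v))

  ▹~∷ : ∀ x w → x ▹ w ~ x ∷ w
  ▹~∷ x []      = Free.refl
  ▹~∷ x (y ∷ w) with y ≟± flipSign x
  ... | yes refl = Star.return (bwd (cancel [] (proj₁ x) (proj₂ x) w))
  ... | no _     = Free.refl

  normalise~ : ∀ w → normalise w ~ w
  normalise~ []      = Free.refl
  normalise~ (x ∷ w) =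
    Free.trans (▹~∷ x (normalise w)) (Free.∙-cong {x = [ x ]} Free.refl (normalise~ w))

  ▹-All : ∀ {P : A × Sign → Set p} {x w} → P x → All P w → All P (x ▹ w)
  ▹-All px [] = px ∷ []
  ▹-All {x = x} {y ∷ w} px (py ∷ pw) with y ≟± flipSign x
  ... | yes _ = pw
  ... | no  _ = px ∷ py ∷ pw

  normalise-All : ∀ {P : A × Sign → Set p} {w} → All P w → All P (normalise w)
  normalise-All []        = []
  normalise-All (px ∷ pw) = ▹-All px (normalise-All pw)

-- Acyclic sets of words

module _ {V : Set v} (_≟_ : DecidableEquality V) (G : Graph V p q) where
  open Graph G

  data Trail : V → V → List V → Set (v ⊔ q) where
    []  : ∀ {x} → Trail x x []
    _∷_ : ∀ {x y z vs} → Adjacent x y → Trail y z vs → Trail x z (y ∷ vs)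

  SimpleTrail : Pred V ℓ → V → V → Set (v ⊔ q ⊔ ℓ)
  SimpleTrail P x z = ∃ λ vs → Trail x z vs × Unique (x ∷ vs) × All P (x ∷ vs)

  private
    restart : ∀ {P : Pred V ℓ} {x y z vs} → y ∈ (x ∷ vs) →
      Trail x z vs → Unique (x ∷ vs) → All P (x ∷ vs) → SimpleTrail P y z
    restart (here refl) t        u       ps       = _ , t , u , ps
    restart (there y∈)  (_ ∷ t)  (_ ∷ u) (_ ∷ ps) = restart y∈ t u ps

  -- Loop erasure: if `x` occurs on the simple trail built from the second vertex, that trail is
  -- restarted at this occurrence. Carrying `P` along ensures that the trail avoids whatever the
  -- walk avoids.
  simplify : ∀ {P : Pred V ℓ} {x z} → P x →
    Star (λ x y → Adjacent x y × P y) x z → SimpleTrail P x z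
  simplify px Star.ε = [] , [] , [] ∷ [] , px ∷ []
  simplify {x = x} px ((xy , py) ◅ ys) with simplify py ys
  ... | vs , t , u , ps with DecMembership._∈?_ _≟_ x (_ ∷ vs)
  ...   | yes x∈ = restart x∈ t u ps
  ...   | no  x∉ = _ , xy ∷ t , ¬Any⇒All¬ _ x∉ ∷ u , px ∷ ps

  private
    close : ∀ {x y z w vs} → Adjacent x y → Trail y z vs → Adjacent z w →
      Linked Adjacent (x ∷ y ∷ vs ++ [ w ])
    close xy []       zw = xy ∷ zw ∷ [-]
    close xy (yy′ ∷ t) zw = xy ∷ close yy′ t zw

  -- A simple trail from `y` to `z` that misses `x` closes up through `x` to a cycle, unless it is
  -- empty and `y` is `z`.
  neighbours-connected-avoiding : ¬ Cycle G → ∀ {x y z} → x ≢ y →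
    Star (λ u v → Adjacent u v × x ≢ v) y z →
    Adjacent x y → Adjacent z x → y ≡ z
  neighbours-connected-avoiding acyclic {x} {y} {z} x≢y walk xy zx
    with simplify x≢y walk
  ... | _ , []          , _ , _  = refl
  ... | _ , t@(_ ∷ _)   , u , ps = contradiction
        (record
          { start    = x
          ; others   = y ∷ _
          ; closed   = close xy t zx
          ; distinct = ps ∷ u
          ; long     = s≤s (s≤s z≤n)
          })
        acyclic

module _ {A : Set a} where

  data StartsWith (x : A) : List A → Set a where
    starts : ∀ {u} → StartsWith x (x ∷ u)

  startsWith-unique : ∀ {x y : A} {u} → StartsWith x u → StartsWith y u → x ≡ y
  startsWith-unique starts starts = refl

  infix 4 _∥_
  -- Incomparability in the prefix order, in positive form: there is a first position, present in
  -- both words, where they differ.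
  data _∥_ : Rel (List A) a where
    differ : ∀ {x y u v} → x ≢ y → x ∷ u ∥ y ∷ v
    _∷_    : ∀ x {u v} → u ∥ v → x ∷ u ∥ x ∷ v

  ∥-tail : ∀ {x : A} {u v} → x ∷ u ∥ x ∷ v → u ∥ v
  ∥-tail (differ x≢x) = contradiction refl x≢x
  ∥-tail (x ∷ p)      = p

  ∥-startsˡ : ∀ {u v} → u ∥ v → ∃ λ x → StartsWith x u
  ∥-startsˡ (differ _) = _ , starts
  ∥-startsˡ (x ∷ _)    = x , starts

  ∥-startsʳ : ∀ {u v} → u ∥ v → ∃ λ x → StartsWith x v
  ∥-startsʳ (differ _) = _ , starts
  ∥-startsʳ (x ∷ _)    = x , starts

  factor-++ : ∀ (u : List A) v → Factor u (u ++ v)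
  factor-++ u v = here (prefix u)
    where
    prefix : ∀ u → Prefix _≡_ u (u ++ v)
    prefix []      = []
    prefix (x ∷ u) = refl ∷ prefix u

  factor-ʳ++ : ∀ u {v w : List A} → Factor v w → Factor v (u ʳ++ w)
  factor-ʳ++ []      p = p
  factor-ʳ++ (x ∷ u) p = factor-ʳ++ u (there p)

-- Paths in bipartite graphs

module _ {V : Set v} where

  -- (y₁ , x₁) ∷ ⋯ ∷ (yₖ , xₖ) ∷ [] encodes the path x₀ y₁ x₁ ⋯ yₖ xₖ of a
  -- bipartite graph, for an x₀ given separately.
  Steps : Set v
  Steps = List (V × V)

  data First (R : Rel V ℓ) (y : V) : Steps → Set (v ⊔ ℓ) where
    []   : First R y []
    next : ∀ {y′ x ps} → R y y′ → First R y ((y′ , x) ∷ ps)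

  -- D is the incidence relation; T relates vertices two steps apart.
  data Path (D : Rel V ℓ) (T : Rel V t) : V → Steps → Set (v ⊔ ℓ ⊔ t) where
    []   : ∀ {x} → Path D T x []
    step : ∀ {x y x′ ps} → D x y → D x′ y → T x x′ → First T y ps →
           Path D T x′ ps → Path D T x ((y , x′) ∷ ps)

  end : V → Steps → V
  end x []              = x
  end _ ((_ , x) ∷ ps) = end x ps

  end-++ : ∀ x ps {qs} → end x (ps ++ qs) ≡ end (end x ps) qs
  end-++ x []             = refl
  end-++ _ ((_ , x) ∷ ps) = end-++ x ps

  -- If x₀ y₁ x₁ ⋯ yₖ xₖ is encoded by (y₁ , x₁) ∷ ps, then shift x₁ ps
  -- encodes y₁ x₁ ⋯ yₖ.
  shift : V → Steps → Steps
  shift x []              = []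
  shift x ((y , x′) ∷ ps) = (x , y) ∷ shift x′ ps

  shift-proj₂ : ∀ x ps → map proj₂ (shift x ps) ≡ map proj₁ ps
  shift-proj₂ x []              = refl
  shift-proj₂ x ((y , x′) ∷ ps) = cong (y ∷_) (shift-proj₂ x′ ps)

  length-shift : ∀ x ps → length (shift x ps) ≡ length ps
  length-shift x []              = refl
  length-shift x ((y , x′) ∷ ps) = cong suc (length-shift x′ ps)

  module _ {D : Rel V ℓ} {T : Rel V t} where

    -- Splitting forgets the condition `T` between the two `y`s around the junction, so the left
    -- piece ends with an empty `First`.
    path-++ : ∀ {x} ps {qs} → Path D T x (ps ++ qs) →
      Path D T x ps × Path D T (end x ps) qs
    path-++ []       p                    = [] , p
    path-++ (_ ∷ []) (step d d′ t f p)    = step d d′ t [] [] , p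
    path-++ (_ ∷ ps@(_ ∷ _)) (step d d′ t (next f) p) with path-++ ps p
    ... | p₁ , p₂ = step d d′ t (next f) p₁ , p₂

    path-shift : ∀ {x y x′ ps} → Path D T x ((y , x′) ∷ ps) →
      Path (flip D) T y (shift x′ ps)
    path-shift (step _ _ _ [] p) = []
    path-shift (step _ d _ (next f) p@(step e _ t g _)) =
      step d e f (first-shift t g) (path-shift p)
      where
      first-shift : ∀ {x x′ y ps} → T x x′ → First T y ps → First T x (shift x′ ps)
      first-shift t []    = []
      first-shift t (next _) = next t

    end-incident : ∀ {x y x′ ps} → Path D T x ((y , x′) ∷ ps) →
      D (end x′ ps) (end y (shift x′ ps))
    end-incident (step _ d _ _ [])            = d
    end-incident (step _ _ _ _ p@(step _ _ _ _ _)) = end-incident p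

  module _ {D : Rel V ℓ} {D′ : Rel V q} {T : Rel V t} where

    path-map : (∀ {x y} → D x y → D′ x y) → ∀ {x ps} → Path D T x ps → Path D′ T x ps
    path-map f []                = []
    path-map f (step d d′ t q p) = step (f d) (f d′) t q (path-map f p)

-- Contexts around a word and their first letters

data Side : Set where
  left right : Side

other : Side → Side
other left  = right
other right = left

module _ {A : Set a} where

  -- Left contexts are written backwards, so on either side the letter next
  -- to w comes first.
  around : List A → Side → List A → List A → List A
  around w left  u v = u ʳ++ (w ++ v)
  around w right u v = v ʳ++ (w ++ u)

  -- A record, because `around` is not injective: `w`, `σ`, `u` and `v` can then be inferred from
  -- the type.
  record Incident (P : Pred (List A) s) (w : List A) (σ : Side) (u v : List A) : Set s where
    constructor incident
    field around∈ : P (around w σ u v)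

module Convexity {A : Set a} (_≟_ : DecidableEquality A) (S : Pred (List A) s)
  (factorial : Factorial S)
  (acyclic : ∀ {w} → S w → ¬ Cycle (extensionGraph S w)) where

  incident-flip : ∀ {w} σ {u v} → Incident S w σ u v → Incident S w (other σ) v u
  incident-flip left  (incident p) = incident p
  incident-flip right (incident p) = incident p

  grow : Side → A → List A → List A
  grow left  x w = x ∷ w
  grow right x w = w ++ [ x ]

  incident-grow : ∀ {w x} σ {u v} → Incident S w σ u (x ∷ v) →
    Incident S (grow (other σ) x w) σ u v
  incident-grow {w} left {u} {v} (incident p) =
    incident (subst (S ∘ (u ʳ++_)) (sym (++-assoc w _ v)) p)
  incident-grow right (incident p) = incident p

  incident-word : ∀ {w} σ {u v} → Incident S w σ u v → S w
  incident-word {w} left  {u} {v} (incident p) = factorial (factor-ʳ++ u (factor-++ w v)) p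
  incident-word {w} right {u} {v} (incident p) = factorial (factor-ʳ++ v (factor-++ w u)) p

  vertex : Side → A → A ⊎ A
  vertex left  = inj₁
  vertex right = inj₂

  vertex-injective : ∀ σ {x y} → vertex σ x ≡ vertex σ y → x ≡ y
  vertex-injective left  refl = refl
  vertex-injective right refl = refl

  vertex-other : ∀ σ {x y} → vertex σ x ≢ vertex (other σ) y
  vertex-other left  ()
  vertex-other right ()

  incident-edge : ∀ {w x y} u v → S ((x ∷ u) ʳ++ (w ++ y ∷ v)) → E S w x y
  incident-edge {w} {x} {y} u v p = factorial
    (subst (Factor _) (cong (u ʳ++_) (cong (x ∷_) (++-assoc w [ y ] v)))
      (factor-ʳ++ u (factor-++ (x ∷ w ++ [ y ]) v))) p

  adjacent : ∀ {w x y} σ {u v} → Incident S w σ u v → StartsWith x u → StartsWith y v →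
    ExtAdjacent S w (vertex σ x) (vertex (other σ) y)
  adjacent left  (incident p) (starts {u}) (starts {v}) = left-right (incident-edge u v p)
  adjacent right (incident p) (starts {u}) (starts {v}) = right-left (incident-edge v u p)

  adjacent-flip : ∀ {w x y} → ExtAdjacent S w x y → ExtAdjacent S w y x
  adjacent-flip (left-right p) = right-left p
  adjacent-flip (right-left p) = left-right p

  _≟ᵛ_ : DecidableEquality (A ⊎ A)
  _≟ᵛ_ = Sum.≡-dec _≟_ _≟_

  ReducedPath : List A → Side → List A → Steps → Set (a ⊔ s)
  ReducedPath w σ = Path (Incident S w σ) _∥_

  Avoids : A → List A → Set a
  Avoids x u = ∃ λ y → StartsWith y u × y ≢ x

  -- The nonempty rest `q ∷ qs` excludes the end of the path; its start counts, since `ps` may be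
  -- empty.
  data Visits (x : A) : List A → Steps → Set a where
    visits : ∀ {u} ps {q : List A × List A} {qs} →
      StartsWith x (end u ps) → Visits x u (ps ++ q ∷ qs)

  -- The first components of `shift u ps` are the vertices on the side of `u` other than the last
  -- one, so the second alternative is the negation of the first.
  visits? : ∀ {w σ y} x {u ps} → StartsWith y u → ReducedPath w σ u ps →
    Visits x u ps ⊎ All (Avoids x ∘ proj₁) (shift u ps)
  visits? x h [] = inj₂ []
  visits? {y = y} x {u} h (step _ _ t _ p) with y ≟ x
  ... | yes refl = inj₁ (visits [] h)
  ... | no  y≢x with visits? x (proj₂ (∥-startsʳ t)) p
  ...   | inj₁ (visits ps h′) = inj₁ (visits (_ ∷ ps) h′)
  ...   | inj₂ avoid          = inj₂ ((_ , h , y≢x) ∷ avoid)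

  -- First letters of incident contexts form an edge of the extension graph of `w`, so a path of
  -- contexts projects to a walk there. Only its vertices on side `σ` could meet `x`, and those come
  -- from contexts that avoid it.
  letter-walk : ∀ {w σ x y z u ps} →
    Path (flip (Incident S w σ)) _∥_ u ps → All (Avoids x ∘ proj₁) ps →
    StartsWith y u → StartsWith z (end u ps) →
    Star (λ k l → ExtAdjacent S w k l × vertex σ x ≢ l)
         (vertex (other σ) y) (vertex (other σ) z)
  letter-walk [] [] h h′ with startsWith-unique h h′
  ... | refl = Star.ε
  letter-walk {σ = σ} (step d d′ t f p) ((b , hb , b≢x) ∷ avoid) h h′ =
    (adjacent-flip (adjacent σ d hb h) , λ eq → b≢x (sym (vertex-injective σ eq))) ◅
    (adjacent σ d′ hb (proj₂ (∥-startsʳ t)) , vertex-other σ) ◅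
    letter-walk p avoid (proj₂ (∥-startsʳ t)) h′

  -- x₀ starts with x, and so does xₖ; no xᵢ in between does.
  interior-ends-agree : ∀ {w σ x y z u v u′ ps} →
    ReducedPath w σ u ((v , u′) ∷ ps) → All (Avoids x ∘ proj₁) (shift u′ ps) →
    StartsWith x u → StartsWith x (end u′ ps) →
    StartsWith y v → StartsWith z (end v (shift u′ ps)) → y ≡ z
  interior-ends-agree {σ = σ} p@(step d _ _ _ _) avoid hu hu′ hv hv′ =
    -- The vertex `x` on side `σ` is adjacent to `y` by the first edge of the path and to `z` by the
    -- last.
    vertex-injective (other σ)
      (neighbours-connected-avoiding _≟ᵛ_ (extensionGraph S _)
        (acyclic (incident-word σ d)) (vertex-other σ)
        (letter-walk (path-shift p) avoid hv hv′)
        (adjacent σ d hu hv)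
        (adjacent-flip (adjacent σ (end-incident p) hu′ hv′)))

  strip : Steps {V = List A} → Steps
  strip = map (map₁ (drop 1))

  strip-proj₂ : ∀ ps → map proj₂ (strip ps) ≡ map proj₂ ps
  strip-proj₂ []       = refl
  strip-proj₂ (p ∷ ps) = cong (proj₂ p ∷_) (strip-proj₂ ps)

  strip-end : ∀ u ps → end u (strip ps) ≡ end u ps
  strip-end u []             = refl
  strip-end _ ((_ , u) ∷ ps) = strip-end u ps

  path-strip : ∀ {w σ x u ps} → ReducedPath w σ u ps →
    All (StartsWith x ∘ proj₁) ps → ReducedPath (grow (other σ) x w) σ u (strip ps)
  path-strip [] [] = []
  path-strip {σ = σ} (step d d′ t f p) (starts ∷ hs) =
    step (incident-grow σ d) (incident-grow σ d′) t (first f hs)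
      (path-strip p hs)
    where
    first : ∀ {x v ps} → First _∥_ (x ∷ v) ps → All (StartsWith x ∘ proj₁) ps →
      First _∥_ v (strip ps)
    first []    _            = []
    first (next q) (starts ∷ _) = next (∥-tail q)

  end-starts : ∀ {D : Rel (List A) ℓ} {x u ps} → Path D _∥_ u ps → StartsWith x u →
    ∃ λ y → StartsWith y (end u ps)
  end-starts []               h = _ , h
  end-starts (step _ _ t _ p) h = end-starts p (proj₂ (∥-startsʳ t))

  length-++-∷ : ∀ (ps : Steps {V = List A}) {q qs} → suc (length ps) ≤ length (ps ++ q ∷ qs)
  length-++-∷ []       = s≤s z≤n
  length-++-∷ (_ ∷ ps) = s≤s (length-++-∷ ps)

  firstLength : Steps {V = List A} → ℕ
  firstLength []            = 0
  firstLength ((v , _) ∷ _) = length v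

  -- If x₀ and xₖ start with x and no xᵢ in between does, then the yⱼ all start
  -- with the same letter, by acyclicity for y₁ and yₖ and by induction in
  -- between.  This letter is moved into w; since consecutive yⱼ are
  -- incomparable, it cannot exhaust them.
  ends⇒all-startWith : ∀ n m {w σ x u ps} → length ps ≤ n → firstLength ps ≤ m →
    ReducedPath w σ u ps → StartsWith x u → StartsWith x (end u ps) →
    All (StartsWith x) (map proj₂ ps)
  visit⇒all-startWith : ∀ n {w σ x u v u′ ps} → suc (length ps) ≤ n →
    ReducedPath w σ u ((v , u′) ∷ ps) → StartsWith x u →
    Visits x u′ ps → StartsWith x (end u′ ps) →
    All (StartsWith x) (u′ ∷ map proj₂ ps)

  avoid⇒all-startWith : ∀ n m {w σ x y u v u′ ps} →
    suc (length ps) ≤ n → length v ≤ m →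
    ReducedPath w σ u ((v , u′) ∷ ps) → StartsWith x u →
    All (Avoids x ∘ proj₁) (shift u′ ps) → StartsWith x (end u′ ps) →
    StartsWith y v → All (StartsWith x) (u′ ∷ map proj₂ ps)

  ends⇒all-startWith _ _ _ _ []                 _ _ = []
  ends⇒all-startWith _ _ _ _ (step _ _ _ [] []) _ h = h ∷ []
  ends⇒all-startWith n m {x = x} len len′ p@(step _ _ t (next f) q) h h′
    with visits? x (proj₂ (∥-startsʳ t)) q
  ... | inj₁ visit = visit⇒all-startWith n len p h visit h′
  ... | inj₂ avoid = avoid⇒all-startWith n m len len′ p h avoid h′ (proj₂ (∥-startsˡ f))

  visit⇒all-startWith (suc n) {u = u} {v} {u′} (s≤s len) p h (visits ps₁ {r} {ps₂} hv) h′
    -- Both pieces are shorter than the path, and their end points start with `x`.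
    with path-++ ((v , u′) ∷ ps₁) p
  ... | p₁ , p₂ = subst (All _) (sym (map-++ proj₂ ((v , u′) ∷ ps₁) (r ∷ ps₂))) (++⁺
    (ends⇒all-startWith n _ (≤-trans (length-++-∷ ps₁) len) ≤-refl p₁ h hv)
    (ends⇒all-startWith n _ (≤-trans (length-++-≤ʳ (r ∷ ps₂) {ps₁}) len) ≤-refl p₂ hv
      (subst (StartsWith _) (end-++ u′ ps₁) h′)))

  avoid⇒all-startWith (suc n) (suc m) {u = u} {v} {u′} {ps} (s≤s len) (s≤s len′)
    p h avoid h′ starts =
    subst (All _) (strip-proj₂ ((v , u′) ∷ ps))
      -- The number of steps is unchanged, but the first `y` has lost a letter, so `m` decreases.
      (ends⇒all-startWith (suc n) m
        (s≤s (≤-trans (≤-reflexive (length-map _ ps)) len)) len′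
        (path-strip p (starts ∷ map⁻ (subst (All _) (shift-proj₂ u′ ps) ys))) h
        (subst (StartsWith _) (sym (strip-end u ((v , u′) ∷ ps))) h′))
    where
    ys : All (StartsWith _) (map proj₂ (shift u′ ps))
    ys with end-starts (path-shift p) starts
    ... | _ , hz with interior-ends-agree p avoid h h′ starts hz
    -- The shifted path is one step shorter, with the sides exchanged; as `n` decreases, `m` may be
    -- reset.
    ...   | refl = ends⇒all-startWith n _
      (≤-trans (≤-reflexive (length-shift u′ ps)) len) ≤-refl
      (path-map (incident-flip _) (path-shift p)) starts hz

-- Bifix codes in acyclic sets

module _ {A : Set a} where

  data Comparison : Rel (List A) a where
    incomparable : ∀ {u v} → u ∥ v → Comparison u v
    prefix       : ∀ {u} v → Comparison u (u ++ v)
    extension    : ∀ {u} v → Comparison (u ++ v) u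

  compare : DecidableEquality A → ∀ u v → Comparison u v
  compare _≟_ []      v       = prefix v
  compare _≟_ (x ∷ u) []      = extension (x ∷ u)
  compare _≟_ (x ∷ u) (y ∷ v) with x ≟ y
  ... | no x≢y   = incomparable (differ x≢y)
  ... | yes refl with compare _≟_ u v
  ...   | incomparable u∥v = incomparable (x ∷ u∥v)
  ...   | prefix v         = prefix v
  ...   | extension v      = extension v

  record IsBifixCode (X : Pred (List A) q) : Set (a ⊔ q) where
    field
      prefix-free : ∀ u v → X u → X (u ++ v) → v ≡ []
      suffix-free : ∀ u v → X v → X (u ++ v) → u ≡ []

ʳ++-++ : ∀ {A : Set a} (u {v w} : List A) → (u ʳ++ v) ++ w ≡ u ʳ++ (v ++ w)
ʳ++-++ []      = refl
ʳ++-++ (x ∷ u) = ʳ++-++ u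

module Saturation {A : Set a} (_≟_ : DecidableEquality A) (S : Pred (List A) s)
  (factorial : Factorial S)
  (acyclic : ∀ {w} → S w → ¬ Cycle (extensionGraph S w))
  {X : Pred (List A) q} (isBifixCode : IsBifixCode X) (X⊆S : X ⊆ S) where

  open IsBifixCode isBifixCode
  open Convexity _≟_ S factorial acyclic
  open NormalForm _≟_

  Splits : Side → Rel (List A) q
  Splits = Incident X []

  prefix-freeʳ : ∀ u {v v′} → X (u ʳ++ v) → X (u ʳ++ (v ++ v′)) → v′ ≡ []
  prefix-freeʳ u {v′ = v′} p q = prefix-free _ v′ p (subst X (sym (ʳ++-++ u)) q)

  suffix-freeʳ : ∀ u {v} → X v → X (u ʳ++ v) → u ≡ []
  suffix-freeʳ u {v} p q =
    reverse-injective (suffix-free (reverse u) v p (subst X (ʳ++-defn u) q))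

  -- If one completion extended the other, a word of `X` would be a proper prefix of another.
  splits-∥ʳ : ∀ {u v v′} → X (u ʳ++ v) → X (u ʳ++ v′) → v ≢ v′ → v ∥ v′
  splits-∥ʳ {u} {v} {v′} p q v≢v′ with compare _≟_ v v′
  ... | incomparable v∥v′ = v∥v′
  ... | prefix t    with refl ← prefix-freeʳ u p q = contradiction (sym (++-identityʳ v)) v≢v′
  ... | extension t with refl ← prefix-freeʳ u q p = contradiction (++-identityʳ v′) v≢v′

  splits-∥ˡ : ∀ {u u′ v} → X (u ʳ++ v) → X (u′ ʳ++ v) → u ≢ u′ → u ∥ u′
  splits-∥ˡ {u} {u′} {v} p q u≢u′ with compare _≟_ u u′
  ... | incomparable u∥u′ = u∥u′
  ... | prefix t    with refl ← suffix-freeʳ t p (subst X (++-ʳ++ u) q) =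
        contradiction (sym (++-identityʳ u)) u≢u′
  ... | extension t with refl ← suffix-freeʳ t q (subst X (++-ʳ++ u′) p) =
        contradiction (++-identityʳ u′) u≢u′

  splits-∥ : ∀ {σ u u′ v} → Splits σ u v → Splits σ u′ v → u ≢ u′ → u ∥ u′
  splits-∥ {left}          (incident p) (incident q) = splits-∥ˡ p q
  splits-∥ {right} {v = v} (incident p) (incident q) = splits-∥ʳ {v} p q

  _≟*_ : DecidableEquality (List A)
  _≟*_ = ≡-dec _≟_

  Siblings : Side → Rel (List A) (a ⊔ q)
  Siblings σ u u′ = ∃ λ v → Splits σ u v × Splits σ u′ v

  ReducedSteps : Side → Rel (List A) (a ⊔ q)
  ReducedSteps σ u u′ = ∃ λ ps → Path (Splits σ) _∥_ u ps × end u ps ≡ u′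

  -- Free reduction: a step that stays in place is dropped, and two steps through the same `v` are
  -- merged into one, which is then prepended to a shorter path. What remains distinct is
  -- incomparable by `splits-∥`.
  prepend : ∀ {σ u u′ v} ps → Splits σ u v → Splits σ u′ v → Path (Splits σ) _∥_ u′ ps →
    ReducedSteps σ u (end u′ ps)
  prepend {σ} {u} {u′} {v} ps d d′ p with u ≟* u′
  ... | yes refl = ps , p , refl
  prepend [] d d′ p | no u≢u′ = _ , step d d′ (splits-∥ d d′ u≢u′) [] [] , refl
  prepend {σ} {v = v} ((v′ , _) ∷ ps) d d′ p@(step e e′ _ _ q) | no u≢u′ with v ≟* v′
  ... | yes refl = prepend ps d e′ q
  ... | no v≢v′  = _ , step d d′ (splits-∥ d d′ u≢u′)
                        (next (splits-∥ (splits-flip d′) (splits-flip e) v≢v′)) p , refl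
    where
    splits-flip : ∀ {σ u v} → Splits σ u v → Splits (other σ) v u
    splits-flip {left}  (incident p) = incident p
    splits-flip {right} (incident p) = incident p

  reduce : ∀ {σ u u′} → Star (Siblings σ) u u′ → ReducedSteps σ u u′
  reduce Star.ε = [] , [] , refl
  reduce ((v , d , d′) ◅ l) with reduce l
  ... | ps , p , refl = prepend ps d d′ p

  splits-∈S : ∀ {σ u v} → Splits σ u v → Incident S [] σ u v
  splits-∈S (incident p) = incident (X⊆S p)

  -- The case `w = []` of the convexity statement, applied to a reduced path. A class of linked
  -- words thus stays connected when restricted to a given first letter.
  convex : ∀ {σ y u u′} → Star (Siblings σ) (y ∷ u) (y ∷ u′) →
    ∃ λ ps → Path (Splits σ) _∥_ (y ∷ u) ps × end (y ∷ u) ps ≡ y ∷ u′ ×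
             All (StartsWith y) (map proj₂ ps)
  convex l with reduce l
  ... | ps , p , eq = ps , p , eq ,
    ends⇒all-startWith _ _ ≤-refl ≤-refl (path-map splits-∈S p)
      starts (subst (StartsWith _) (sym eq) starts)

  -- The states of the Stallings graph of X are the prefixes u of X, written
  -- backwards, modulo ≋; the state of [] is the base point.
  _≈_ : Rel (List A) (a ⊔ q)
  _≈_ = Star (Siblings left)

  link : ∀ {u u′} v → X (u ʳ++ v) → X (u′ ʳ++ v) → u ≈ u′
  link v p q = (v , incident p , incident q) ◅ Star.ε

  -- The second case is a whole word of `X`, written backwards: reading it leads back to the base
  -- point.
  IsBase : Pred (List A) (a ⊔ q)
  IsBase u = u ≡ [] ⊎ X (u ʳ++ [])

  _≋_ : Rel (List A) (a ⊔ q)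
  u ≋ v = u ≈ v ⊎ (IsBase u × IsBase v)

  ≈-sym : ∀ {u v} → u ≈ v → v ≈ u
  ≈-sym = Star.reverse (λ { (v , d , d′) → v , d′ , d })

  -- By suffix-freeness `[]` has no sibling but itself; by prefix-freeness a word of `X` has only
  -- the completion `[]`, so its siblings are again words of `X`.
  ≈-isBase : ∀ {u v} → u ≈ v → IsBase u → IsBase v
  ≈-isBase Star.ε b = b
  ≈-isBase ((v , incident d , incident d′) ◅ l) (inj₁ refl) =
    ≈-isBase l (inj₁ (suffix-freeʳ _ d d′))
  ≈-isBase {u} ((v , incident d , incident d′) ◅ l) (inj₂ p) with refl ← prefix-freeʳ u p d =
    ≈-isBase l (inj₂ d′)

  ≋-refl : ∀ {u} → u ≋ u
  ≋-refl = inj₁ Star.ε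

  ≋-sym : ∀ {u v} → u ≋ v → v ≋ u
  ≋-sym (inj₁ l)        = inj₁ (≈-sym l)
  ≋-sym (inj₂ (b , b′)) = inj₂ (b′ , b)

  ≋-isBase : ∀ {u v} → u ≋ v → IsBase u → IsBase v
  ≋-isBase (inj₁ l)        = ≈-isBase l
  ≋-isBase (inj₂ (_ , b′)) = λ _ → b′

  ≋-trans : ∀ {u v w} → u ≋ v → v ≋ w → u ≋ w
  ≋-trans (inj₁ l)        (inj₁ l′)       = inj₁ (l ◅◅ l′)
  ≋-trans (inj₂ (b , b′)) m               = inj₂ (b , ≋-isBase m b′)
  ≋-trans l@(inj₁ _)      (inj₂ (b , b′)) = inj₂ (≋-isBase (≋-sym l) b , b′)

  -- Determinism forwards. The chain from `u` to `u′` also links the completions `y ∷ r` and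
  -- `y ∷ r′`. By convexity all completions on the way may be taken to start with `y`, and this
  -- letter is then moved over to the prefixes.
  ≈-∷ : ∀ {y u u′ r r′} → u ≈ u′ →
    X ((y ∷ u) ʳ++ r) → X ((y ∷ u′) ʳ++ r′) → (y ∷ u) ≈ (y ∷ u′)
  ≈-∷ {y} {u} {u′} {r} {r′} l p q with convex (right-links {v = y ∷ r} {y ∷ r′} l p q)
    where
    right-links : ∀ {u u′ v v′} → u ≈ u′ → X (u ʳ++ v) → X (u′ ʳ++ v′) →
      Star (Siblings right) v v′
    right-links {u} Star.ε p q = (u , incident p , incident q) ◅ Star.ε
    right-links {u} ((_ , incident d , incident d′) ◅ l) p q =
      (u , incident p , incident d) ◅ right-links l d′ q
  ... | ps , path , eq , all = follow path eq all p
    where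
    follow : ∀ {u r ps} → Path (Splits right) _∥_ (y ∷ r) ps → end (y ∷ r) ps ≡ y ∷ r′ →
      All (StartsWith y) (map proj₂ ps) → X ((y ∷ u) ʳ++ r) → (y ∷ u) ≈ (y ∷ u′)
    follow {u} [] refl [] p = link {y ∷ u} {y ∷ u′} r′ p q
    follow {u} {r} (step {y = v} (incident d) (incident d′) _ _ path) eq (starts ∷ all) p =
      link {y ∷ u} {y ∷ v} r p d ◅◅ follow path eq all d′

  -- Determinism backwards. By convexity all prefixes on the way may be taken to end (read forwards)
  -- with `y`, and this letter is moved over to the completions.
  ≈-∷⁻ : ∀ {y u u′} → (y ∷ u) ≈ (y ∷ u′) → u ≈ u′
  ≈-∷⁻ {y} {u′ = u′} l with convex l
  ... | ps , path , eq , all = follow path eq all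
    where
    follow : ∀ {u ps} → Path (Splits left) _∥_ (y ∷ u) ps → end (y ∷ u) ps ≡ y ∷ u′ →
      All (StartsWith y) (map proj₂ ps) → u ≈ u′
    follow [] refl [] = Star.ε
    follow (step {y = v} (incident d) (incident d′) _ _ path) eq (starts ∷ all) =
      link (y ∷ v) d d′ ◅◅ follow path eq all

  prefix-isBase⇒[] : ∀ {y u r} → X ((y ∷ u) ʳ++ r) → IsBase u → u ≡ []
  prefix-isBase⇒[] _ (inj₁ refl) = refl
  prefix-isBase⇒[] {u = u} p (inj₂ q) with () ← prefix-freeʳ u q p

  ≋-∷ : ∀ {y u u′ r r′} → u ≋ u′ →
    X ((y ∷ u) ʳ++ r) → X ((y ∷ u′) ʳ++ r′) → (y ∷ u) ≋ (y ∷ u′)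
  ≋-∷ (inj₁ l) p q = inj₁ (≈-∷ l p q)
  ≋-∷ (inj₂ (b , b′)) p q
    with refl ← prefix-isBase⇒[] p b | refl ← prefix-isBase⇒[] q b′ = ≋-refl

  ≋-∷⁻ : ∀ {y u u′} → (y ∷ u) ≋ (y ∷ u′) → u ≋ u′
  ≋-∷⁻ (inj₁ l)                 = inj₁ (≈-∷⁻ l)
  -- A nonempty base state is a word of `X`, so `u` and `u′` share the completion `[ y ]`.
  ≋-∷⁻ {y} (inj₂ (inj₂ p , inj₂ q)) = inj₁ (link [ y ] p q)

  -- Reading signed words in the Stallings graph

  record Arrow (y : A) (u v : List A) : Set (a ⊔ q) where
    constructor arrow
    field
      {source rest} : List A
      from          : u ≋ source
      word          : X ((y ∷ source) ʳ++ rest)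
      to            : (y ∷ source) ≋ v

  Move : A × Sign → Rel (List A) (a ⊔ q)
  Move (y , pos) u v = Arrow y u v
  Move (y , neg) u v = Arrow y v u

  move-flip : ∀ z {u v} → Move z u v → Move (flipSign z) v u
  move-flip (_ , pos) m = m
  move-flip (_ , neg) m = m

  -- This is foldedness: `≋-∷` treats two edges leaving a state, `≋-∷⁻` two edges entering it.
  move-deterministic : ∀ z {u v v′} → Move z u v → Move z u v′ → v ≋ v′
  move-deterministic (_ , pos) (arrow f p t) (arrow f′ p′ t′) =
    ≋-trans (≋-sym t) (≋-trans (≋-∷ (≋-trans (≋-sym f) f′) p p′) t′)
  move-deterministic (_ , neg) (arrow f _ t) (arrow f′ _ t′) =
    ≋-trans f (≋-trans (≋-∷⁻ (≋-trans t (≋-sym t′))) (≋-sym f′))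

  move-resp : ∀ z {u u′ v} → u ≋ u′ → Move z u′ v → Move z u v
  move-resp (_ , pos) l (arrow f p t) = arrow (≋-trans l f) p t
  move-resp (_ , neg) l (arrow f p t) = arrow f p (≋-trans t (≋-sym l))

  data Run : SignedWord A → Rel (List A) (a ⊔ q) where
    []  : ∀ {u v} → u ≋ v → Run [] u v
    _∷_ : ∀ {z w u v v′} → Move z u v → Run w v v′ → Run (z ∷ w) u v′

  run-resp : ∀ {w u u′ v} → u ≋ u′ → Run w u′ v → Run w u v
  run-resp l ([] l′)          = [] (≋-trans l l′)
  run-resp l (_∷_ {z} m run) = move-resp z l m ∷ run

  run-++ : ∀ {w w′ u v v′} → Run w u v → Run w′ v v′ → Run (w ++ w′) u v′
  run-++ ([] l)    run′ = run-resp l run′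
  run-++ (m ∷ run) run′ = m ∷ run-++ run run′

  run-invert : ∀ {w u v} → Run w u v → Run (invert w) v u
  run-invert ([] l) = [] (≋-sym l)
  run-invert (_∷_ {z} {w} m run) =
    subst (λ w′ → Run w′ _ _) (sym (unfold-reverse (flipSign z) (map flipSign w)))
      (run-++ (run-invert run) (move-flip z m ∷ [] ≋-refl))

  -- By determinism, reading `z` and then its inverse returns to the same state, so a cancelling
  -- pair can be cut out of a run.
  run-▹ : ∀ z {w u v v′} → Move z u v → Run w v v′ → Run (z ▹ w) u v′
  run-▹ z m ([] l) = m ∷ [] l
  run-▹ z m (_∷_ {y} {w} m′ run) with y ≟± flipSign z
  ... | yes refl = run-resp (move-deterministic (flipSign z) (move-flip z m) m′) run
  ... | no  _    = m ∷ m′ ∷ run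

  run-normalise : ∀ {w u v} → Run w u v → Run (normalise w) u v
  run-normalise ([] l)          = [] l
  run-normalise (_∷_ {z} m run) = run-▹ z m (run-normalise run)

  run-ι : ∀ {u} v → X (u ʳ++ v) → Run (ι v) u []
  run-ι []      p = [] (inj₂ (inj₂ p , inj₁ refl))
  run-ι (y ∷ v) p = arrow ≋-refl p ≋-refl ∷ run-ι v p

  run-extend-ι : ∀ {w} → All (X ∘ proj₁) w → Run (extend (freeGroup A) ι w) [] []
  run-extend-ι []                       = [] ≋-refl
  run-extend-ι {(u , pos) ∷ _} (p ∷ ps) = run-++ (run-ι u p) (run-extend-ι ps)
  run-extend-ι {(u , neg) ∷ _} (p ∷ ps) = run-++ (run-invert (run-ι u p)) (run-extend-ι ps)

  letter-saturated : ∀ {y w} → All (X ∘ proj₁) w → extend (freeGroup A) ι w ~ gen y → X [ y ]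
  letter-saturated {y} ps w~y
    -- The word `gen y` is its own normal form, so the loop read by the product becomes a single
    -- arrow at the base point.
    with subst (λ w → Run w [] []) (normalise-~ w~y) (run-normalise (run-extend-ι ps))
  -- The source of the arrow is a proper prefix of a word of `X` and a base state, hence `[]`. The
  -- target `[ y ]` is a nonempty base state, hence a word of `X`.
  ... | arrow f p t ∷ [] l with refl ← prefix-isBase⇒[] p (≋-isBase f (inj₁ refl))
    with ≋-isBase (≋-sym (≋-trans t l)) (inj₁ refl)
  ...   | inj₂ q = q

-- Nielsen reduction

module ~-Reasoning {a} {A : Set a} = SetoidReasoning (Group.setoid (freeGroup A))

glue : ∀ {A : Set a} → Side → List A → List A → List A
glue left  u v = u ++ v
glue right u v = v ++ u

module _ {A : Set a} where

  glue-cong : ∀ σ {u u′ v v′ : SignedWord A} →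
    u ~ u′ → v ~ v′ → glue σ u v ~ glue σ u′ v′
  glue-cong left  p q = Free.∙-cong p q
  glue-cong right p q = Free.∙-cong q p

  ι-glue : ∀ σ (u v : List A) → ι (glue σ u v) ≡ glue σ (ι u) (ι v)
  ι-glue left  u v = map-++ _ u v
  ι-glue right u v = map-++ _ v u

  glue-cancel : ∀ σ {u u′ v : SignedWord A} → u ++ u′ ~ [] → u′ ++ u ~ [] →
    glue σ u (glue σ u′ v) ~ v
  glue-cancel left {u} {u′} {v} p _ =
    Free.trans (Free.sym (Free.assoc u u′ v)) (Free.∙-congʳ p)
  glue-cancel right {u} {u′} {v} _ p =
    Free.trans (Free.assoc v u′ u)
      (Free.trans (Free.∙-congˡ {x = v} p) (Free.identityʳ v))

  factor-glue : ∀ σ (u v : List A) → Factor v (glue σ u v)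
  factor-glue left  u v = u ++ⁱ subst (Factor v) (++-identityʳ v) (factor-++ v [])
  factor-glue right u v = factor-++ v u

  length-glue : ∀ σ (u v : List A) → length (glue σ u v) ≡ length u + length v
  length-glue left  u v = length-++ u
  length-glue right u v = trans (length-++ v) (+-comm (length v) _)

extend-glue : ∀ {I : Set i} {A : Set a} (g : I → SignedWord A) σ u v →
  extend (freeGroup A) g (glue σ u v) ~
  glue σ (extend (freeGroup A) g u) (extend (freeGroup A) g v)
extend-glue g left  u v = extend-++ (freeGroup _) g u v
extend-glue g right u v = extend-++ (freeGroup _) g v u

-- That is, the induced homomorphism from the free group on `I` is an isomorphism. Indexing the
-- family makes a repetition a violation of injectivity.
record FreelyGenerates {I : Set i} {A : Set a} (g : I → SignedWord A) : Set (i ⊔ a) where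
  field
    injective  : ∀ w → extend (freeGroup A) g w ~ [] → w ~ []
    surjective : ∀ u → ∃ λ w → extend (freeGroup A) g w ~ u

module _ {I : Set i} where

  InverseTo : (I → SignedWord I) → (I → SignedWord I) → Set i
  InverseTo τ τ′ = ∀ k → extend (freeGroup I) τ (τ′ k) ~ gen k

  extend-inverse : ∀ τ τ′ → InverseTo τ τ′ → ∀ w →
    extend (freeGroup I) τ (extend (freeGroup I) τ′ w) ~ w
  extend-inverse τ τ′ inv w = begin
    extend (freeGroup I) τ (extend (freeGroup I) τ′ w)
      ≈⟨ extend-extend (freeGroup I) τ τ′ w ⟩
    extend (freeGroup I) (extend (freeGroup I) τ ∘ τ′) w
      ≈⟨ extend-cong (freeGroup I) inv w ⟩
    extend (freeGroup I) gen w
      ≡⟨ extend-gen-id w ⟩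
    w ∎
    where open ~-Reasoning

  module _ {A : Set a} {g h : I → SignedWord A} where

    -- The homomorphism induced by `h` is the one induced by `g` after the automorphism `τ′`.
    freelyGenerates-extend : ∀ τ τ′ → InverseTo τ τ′ → InverseTo τ′ τ →
      (∀ k → h k ~ extend (freeGroup A) g (τ′ k)) →
      FreelyGenerates g → FreelyGenerates h
    freelyGenerates-extend τ τ′ inv inv′ h~ gs = record
      { injective  = λ w hw~[] → Free.trans (Free.sym (extend-inverse τ τ′ inv w))
          (extend-~ (freeGroup I) τ {extend (freeGroup I) τ′ w} {[]}
            (injective (extend (freeGroup I) τ′ w) (Free.trans (Free.sym (via w)) hw~[])))
      ; surjective = λ u → let w , gw~u = surjective u in
          extend (freeGroup I) τ w ,
          Free.trans (via (extend (freeGroup I) τ w))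
            (Free.trans (extend-~ (freeGroup A) g {v = w} (extend-inverse τ′ τ inv′ w)) gw~u)
      }
      where
      open FreelyGenerates gs
      via : ∀ w → extend (freeGroup A) h w ~
                  extend (freeGroup A) g (extend (freeGroup I) τ′ w)
      via w = Free.trans (extend-cong (freeGroup A) h~ w)
        (Free.sym (extend-extend (freeGroup A) g τ′ w))

  automorphism : ∀ τ τ′ → InverseTo τ τ′ → InverseTo τ′ τ → Automorphism (freeGroup I)
  automorphism τ τ′ inv inv′ = record
    { ⟦_⟧ = extend (freeGroup I) τ
    ; isGroupIsomorphism = record
      { isGroupMonomorphism = record
        { isGroupHomomorphism = record
          { isMonoidHomomorphism = record
            { isMagmaHomomorphism = record
              { isRelHomomorphism = record { cong = extend-~ (freeGroup I) τ }
              ; homo              = extend-++ (freeGroup I) τ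
              }
            ; ε-homo = Free.refl
            }
          ; ⁻¹-homo = extend-invert (freeGroup I) τ
          }
        ; injective = λ {u} {v} eq → Free.trans (Free.sym (extend-inverse τ′ τ inv′ u))
            (Free.trans (extend-~ (freeGroup I) τ′ eq) (extend-inverse τ′ τ inv′ v))
        }
      ; surjective = λ u → extend (freeGroup I) τ′ u , λ z~ →
          Free.trans (extend-~ (freeGroup I) τ z~) (extend-inverse τ τ′ inv u)
      }
    }

module Update {I : Set i} (_≟_ : DecidableEquality I) where

  infixl 6 _[_↦_]
  _[_↦_] : ∀ {B : Set b} → (I → B) → I → B → I → B
  (f [ k ↦ y ]) l with l ≟ k
  ... | yes _ = y
  ... | no  _ = f l

  update-same : ∀ {B : Set b} (f : I → B) k {y} → (f [ k ↦ y ]) k ≡ y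
  update-same f k with k ≟ k
  ... | yes _  = refl
  ... | no k≢k = contradiction refl k≢k

  update-other : ∀ {B : Set b} (f : I → B) {k l y} → l ≢ k → (f [ k ↦ y ]) l ≡ f l
  update-other f {k} {l} l≢k with l ≟ k
  ... | yes l≡k = contradiction l≡k l≢k
  ... | no  _   = refl

module Transvection {I : Set i} (_≟_ : DecidableEquality I) where
  open Update _≟_

  -- The sign `pos` gives the elementary automorphisms `α′` (left) and `α` (right), the sign `neg`
  -- their inverses.
  transvection : Side → I → I × Sign → I → SignedWord I
  transvection σ k z = gen [ k ↦ glue σ [ z ] (gen k) ]

  extend-transvection-other : ∀ σ k z {l} → l ≢ k → ∀ ε →
    extend (freeGroup I) (transvection σ k z) [ (l , ε) ] ≡ [ (l , ε) ]
  extend-transvection-other σ k z {l} l≢k ε =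
    trans (cong (λ u → power (freeGroup I) (u , ε) ++ []) (update-other gen l≢k)) (power-gen ε)
    where
    power-gen : ∀ ε → power (freeGroup I) (gen l , ε) ++ [] ≡ [ (l , ε) ]
    power-gen pos = refl
    power-gen neg = refl

  transvection-inverse : ∀ σ k l ε → l ≢ k →
    InverseTo (transvection σ k (l , ε)) (transvection σ k (l , opposite ε))
  transvection-inverse σ k l ε l≢k m with m ≟ k
  ... | no m≢k = Free.reflexive (extend-transvection-other σ k _ m≢k pos)
  ... | yes refl = begin
    extend (freeGroup I) τ (glue σ [ (l , opposite ε) ] (gen k))
      ≈⟨ extend-glue τ σ _ (gen k) ⟩
    glue σ (extend (freeGroup I) τ [ (l , opposite ε) ]) (extend (freeGroup I) τ (gen k))
      ≈⟨ glue-cong σ (Free.reflexive (extend-transvection-other σ k _ l≢k (opposite ε)))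
           (Free.trans (extend-gen (freeGroup I) τ k) (Free.reflexive (update-same gen k))) ⟩
    glue σ [ (l , opposite ε) ] (glue σ [ (l , ε) ] (gen k))
      ≈⟨ glue-cancel σ (Free.inverseˡ [ (l , ε) ]) (Free.inverseʳ [ (l , ε) ]) ⟩
    gen k ∎
    where
    open ~-Reasoning
    τ = transvection σ k (l , ε)

  transvectionAut : ∀ σ k l → l ≢ k → Automorphism (freeGroup I)
  transvectionAut σ k l l≢k = automorphism (transvection σ k (l , pos)) (transvection σ k (l , neg))
    (transvection-inverse σ k l pos l≢k) (transvection-inverse σ k l neg l≢k)

  transvection-elementary : ∀ σ k l (l≢k : l ≢ k) → Elementary (transvectionAut σ k l l≢k)
  transvection-elementary left k l l≢k = α′[ k , l ] (l≢k ∘ sym)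
    (Free.trans (extend-gen (freeGroup I) (transvection left k (l , pos)) k)
      (Free.reflexive (update-same gen k)))
    (λ m m≢k → Free.reflexive (extend-transvection-other left k _ m≢k pos))
  transvection-elementary right k l l≢k = α[ k , l ] (l≢k ∘ sym)
    (Free.trans (extend-gen (freeGroup I) (transvection right k (l , pos)) k)
      (Free.reflexive (update-same gen k)))
    (λ m m≢k → Free.reflexive (extend-transvection-other right k _ m≢k pos))

totalLength : ∀ {A : Set a} {m} → Vector (List A) m → ℕ
totalLength = Vector.foldr (λ u n → length u + n) 0

totalLength-mono : ∀ {A : Set a} {m} {f g : Vector (List A) m} →
  (∀ k → length (f k) ≤ length (g k)) → totalLength f ≤ totalLength g
totalLength-mono {m = zero}  f≤g = z≤n
totalLength-mono {m = suc m} f≤g = +-mono-≤ (f≤g zero) (totalLength-mono (f≤g ∘ suc))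

totalLength-mono-< : ∀ {A : Set a} {m} {f g : Vector (List A) m} →
  (∀ k → length (f k) ≤ length (g k)) → ∀ k → length (f k) < length (g k) →
  totalLength f < totalLength g
totalLength-mono-< f≤g zero    f<g = +-mono-<-≤ f<g (totalLength-mono (f≤g ∘ suc))
totalLength-mono-< f≤g (suc k) f<g = +-mono-≤-< (f≤g zero) (totalLength-mono-< (f≤g ∘ suc) k f<g)

module Descent {A : Set a} (_≟_ : DecidableEquality A) where

  _≟*_ : DecidableEquality (List A)
  _≟*_ = ≡-dec _≟_

  splitOff? : ∀ σ (u v : List A) → Dec (∃ λ w → v ≡ glue σ u w)
  splitOff? left [] v = yes (v , refl)
  splitOff? left (x ∷ u) [] = no λ ()
  splitOff? left (x ∷ u) (y ∷ v) =
    map′ (λ { (refl , w , refl) → w , refl }) (λ { (w , refl) → refl , w , refl })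
      (y ≟ x ×-dec splitOff? left u v)
  splitOff? right u [] =
    map′ (λ { refl → [] , refl }) (λ { ([] , eq) → eq }) ([] ≟* u)
  splitOff? right u (y ∷ v) =
    map′ (λ { (inj₁ refl) → [] , refl ; (inj₂ (w , refl)) → y ∷ w , refl })
      (λ { ([] , eq) → inj₁ eq ; (_ ∷ w , refl) → inj₂ (w , refl) })
      ((y ∷ v) ≟* u ⊎-dec splitOff? right u v)

  module _ {m} (f : Vector (List A) m) where

    Reducible : Side → Set a
    Reducible σ = ∃₂ λ k l → l ≢ k × ∃ λ w → f k ≡ glue σ (f l) w

    reducible? : ∀ σ → Dec (Reducible σ)
    reducible? σ = Fin.any? λ k → Fin.any? λ l →
      ¬? (l Fin.≟ k) ×-dec splitOff? σ (f l) (f k)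

  Range : ∀ {m} → Vector (List A) m → Pred (List A) a
  Range f u = ∃ λ k → f k ≡ u

  irreducible⇒isBifixCode : ∀ {m} (f : Vector (List A) m) → (∀ σ → ¬ Reducible f σ) →
    IsBifixCode (Range f)
  irreducible⇒isBifixCode f irr = record
    { prefix-free = λ { _ v (k , refl) (l , eq) → ++-identityʳ-unique (f k) (same left k l v eq) }
    ; suffix-free = λ { u _ (k , refl) (l , eq) → ++-identityˡ-unique u (same right k l u eq) }
    }
    where
    same : ∀ σ k l v → f l ≡ glue σ (f k) v → f k ≡ glue σ (f k) v
    same σ k l v eq with k Fin.≟ l
    ... | yes refl = eq
    ... | no k≢l   = contradiction (l , k , k≢l , v , eq) (irr σ)

  module _ {m} {f : Vector (List A) m} (fs : FreelyGenerates (ι ∘ f)) where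
    open FreelyGenerates fs
    open NormalForm (Fin._≟_ {m})

    nonempty : ∀ k → f k ≢ []
    nonempty k fk≡[] with () ← normalise-~ (injective [ (k , pos) ]
      (Free.reflexive (cong (λ u → ι u ++ []) fk≡[])))

    distinct : ∀ {k l} → k ≢ l → f k ≢ f l
    distinct {k} {l} k≢l fk≡fl
      with () ← trans (sym (▹-∷ (k , pos) {[ (l , neg) ]}
                    ((λ eq → k≢l (sym (cong proj₁ eq))) ∷ [-])))
                  (normalise-~ (injective ((k , pos) ∷ (l , neg) ∷ [])
                    (Free.trans (Free.∙-congˡ {x = ι (f k)} (Free.identityʳ _))
                      (Free.trans (Free.reflexive (cong (λ u → ι (f k) ++ invert (ι u)) (sym fk≡fl)))
                        (Free.inverseʳ (ι (f k)))))))

  -- The bijection `e` is part of the conclusion: it arises for the irreducible family and is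
  -- carried back unchanged along the descent.
  IsTameFamily : ∀ {m} → Vector (List A) m → Set a
  IsTameFamily {m} f = ∃ λ (e : A ↔ Fin m) → ∃ λ α →
    Submonoid (automorphismMonoid (freeGroup A)) Elementary α ×
    (∀ y → Automorphism.⟦_⟧ α (gen y) ~ ι (f (Inverse.to e y)))

  module _ (S : Pred (List A) s) (factorial : Factorial S)
    (acyclic : ∀ {w} → S w → ¬ Cycle (extensionGraph S w)) where

    irreducible⇒tame : ∀ {m} (f : Vector (List A) m) → (∀ k → S (f k)) →
      FreelyGenerates (ι ∘ f) → (∀ σ → ¬ Reducible f σ) → IsTameFamily f
    irreducible⇒tame {m} f f∈S fs irr =
      -- The family lists the alphabet in some order, which `letters` absorbs, so the identity
      -- automorphism serves.
      letters , Monoid.ε (automorphismMonoid (freeGroup A)) , unit , λ y →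
        Free.reflexive (cong ι (sym (proj₂ (letter y))))
      where
      open FreelyGenerates fs
      range∈S : Range f ⊆ S
      range∈S (k , refl) = f∈S k
      open Saturation _≟_ S factorial acyclic (irreducible⇒isBifixCode f irr) range∈S
      letter : ∀ y → ∃ λ k → f k ≡ [ y ]
      letter y = let w , w~y = surjective (gen y) in
        letter-saturated {w = map (map₁ f) w} (map⁺ (All.universal (λ z → proj₁ z , refl) w))
          (Free.trans (Free.reflexive (cong (product (freeGroup A)) (sym (map-∘ w)))) w~y)
      initial : ∀ k → ∃ λ y → StartsWith y (f k)
      initial k with f k | nonempty fs k
      ... | []    | fk≢[] = contradiction refl fk≢[]
      ... | y ∷ _ | _     = y , starts
      -- The word `[ y ]` belongs to the family and is a prefix of every member starting with `y`,
      -- so irreducibility identifies the two indices.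
      letter-initial : ∀ {y k} → StartsWith y (f k) → proj₁ (letter y) ≡ k
      letter-initial {y} {k} h with proj₁ (letter y) Fin.≟ k
      ... | yes eq = eq
      ... | no neq = contradiction (k , _ , neq , splits h) (irr left)
        where
        splits : ∀ {u} → StartsWith y u → ∃ λ w → u ≡ f (proj₁ (letter y)) ++ w
        splits (starts {u}) = u , cong (_++ u) (sym (proj₂ (letter y)))
      letters : A ↔ Fin m
      letters = mk↔ₛ′ (proj₁ ∘ letter) (proj₁ ∘ initial)
        (λ k → letter-initial (proj₂ (initial k)))
        (λ y → startsWith-unique (proj₂ (initial (proj₁ (letter y))))
          (subst (StartsWith y) (sym (proj₂ (letter y))) starts))

    module _ {m} (f : Vector (List A) m) σ {k l} (l≢k : l ≢ k) {w}
      (fk≡ : f k ≡ glue σ (f l) w) where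
      open Update (Fin._≟_ {m})

      reduct : Vector (List A) m
      reduct = f [ k ↦ w ]

      reduct∈S : (∀ j → S (f j)) → ∀ j → S (reduct j)
      reduct∈S f∈S j with j Fin.≟ k
      ... | yes _ = factorial (factor-glue σ (f l) w) (subst S fk≡ (f∈S k))
      ... | no  _ = f∈S j

      -- Solving `fk≡` for `w` multiplies `f k` by the inverse of `f l`, which is a transvection
      -- with sign `neg`.
      reduct-freelyGenerates : FreelyGenerates (ι ∘ f) → FreelyGenerates (ι ∘ reduct)
      reduct-freelyGenerates = freelyGenerates-extend
        (transvection σ k (l , pos)) (transvection σ k (l , neg))
        (transvection-inverse σ k l pos l≢k) (transvection-inverse σ k l neg l≢k) value
        where
        open Transvection (Fin._≟_ {m})
        open ~-Reasoning
        value : ∀ j → ι (reduct j) ~ extend (freeGroup A) (ι ∘ f) (transvection σ k (l , neg) j)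
        value j with j Fin.≟ k
        ... | no _ = Free.sym (extend-gen (freeGroup A) (ι ∘ f) j)
        ... | yes refl = begin
          ι w
            ≈⟨ glue-cancel σ (Free.inverseˡ (ι (f l))) (Free.inverseʳ (ι (f l))) ⟨
          glue σ (invert (ι (f l))) (glue σ (ι (f l)) (ι w))
            ≡⟨ cong (glue σ _) (trans (cong ι fk≡) (ι-glue σ (f l) w)) ⟨
          glue σ (invert (ι (f l))) (ι (f k))
            ≈⟨ glue-cong σ (Free.identityʳ _) (extend-gen (freeGroup A) (ι ∘ f) k) ⟨
          glue σ (extend (freeGroup A) (ι ∘ f) [ (l , neg) ]) (extend (freeGroup A) (ι ∘ f) (gen k))
            ≈⟨ extend-glue (ι ∘ f) σ [ (l , neg) ] (gen k) ⟨
          extend (freeGroup A) (ι ∘ f) (glue σ [ (l , neg) ] (gen k)) ∎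

      reduct-shorter : f l ≢ [] → totalLength reduct < totalLength f
      reduct-shorter fl≢[] = totalLength-mono-< shorter k
        (subst (λ u → length u < length (f k)) (sym (update-same f k)) w<fk)
        where
        positive : ∀ {u : List A} → u ≢ [] → 0 < length u
        positive {[]}    u≢[] = contradiction refl u≢[]
        positive {_ ∷ _} _    = s≤s z≤n
        w<fk : length w < length (f k)
        w<fk = subst (length w <_) (sym (trans (cong length fk≡) (length-glue σ (f l) w)))
          (m<n+m (length w) (positive fl≢[]))
        shorter : ∀ j → length (reduct j) ≤ length (f j)
        shorter j with j Fin.≟ k
        ... | yes refl = <⇒≤ w<fk
        ... | no  _    = ≤-refl

      -- For the letters `x` and `y` with indices `k` and `l`, `α` sends `x` to `w` and `y` to
      -- `f l`. Letting `β` act first, which glues `y` to `x`, turns the image of `x` into `f k` and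
      -- keeps the other images.
      reduct-tame⇒tame : IsTameFamily reduct → IsTameFamily f
      reduct-tame⇒tame (e , α , tame , α-gen) =
        e , Monoid._∙_ (automorphismMonoid (freeGroup A)) α β ,
        mult tame (generator (transvection-elementary σ x y y≢x)) , value
        where
        open Inverse e using (to; from; strictlyInverseˡ; strictlyInverseʳ)
        open Transvection _≟_
        open Automorphism α using (⟦_⟧; ⟦⟧-cong; ∙-homo)
        open ~-Reasoning
        x = from k
        y = from l
        y≢x : y ≢ x
        y≢x eq = l≢k (trans (sym (strictlyInverseˡ l)) (trans (cong to eq) (strictlyInverseˡ k)))
        β = transvectionAut σ x y y≢x
        homo-glue : ∀ σ u v → ⟦ glue σ u v ⟧ ~ glue σ ⟦ u ⟧ ⟦ v ⟧
        homo-glue left  u v = ∙-homo u v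
        homo-glue right u v = ∙-homo v u
        τ = transvection σ x (y , pos)
        reduct-y : reduct (to y) ≡ f l
        reduct-y = trans (cong reduct (strictlyInverseˡ l)) (update-other f l≢k)
        reduct-x : reduct (to x) ≡ w
        reduct-x = trans (cong reduct (strictlyInverseˡ k)) (update-same f k)
        image : ∀ {z} → Dec (z ≡ x) → ⟦ τ z ⟧ ~ ι (f (to z))
        image {z} (no z≢x) = begin
          ⟦ τ z ⟧           ≡⟨ cong ⟦_⟧ (Update.update-other _≟_ gen z≢x) ⟩
          ⟦ gen z ⟧         ≈⟨ α-gen z ⟩
          ι (reduct (to z)) ≡⟨ cong ι (update-other f λ eq →
                                 z≢x (trans (sym (strictlyInverseʳ z)) (cong from eq))) ⟩
          ι (f (to z))      ∎
        image (yes refl) = begin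
          ⟦ τ x ⟧
            ≡⟨ cong ⟦_⟧ (Update.update-same _≟_ gen x) ⟩
          ⟦ glue σ (gen y) (gen x) ⟧
            ≈⟨ homo-glue σ (gen y) (gen x) ⟩
          glue σ ⟦ gen y ⟧ ⟦ gen x ⟧
            ≈⟨ glue-cong σ (α-gen y) (α-gen x) ⟩
          glue σ (ι (reduct (to y))) (ι (reduct (to x)))
            ≡⟨ cong₂ (λ u v → glue σ (ι u) (ι v)) reduct-y reduct-x ⟩
          glue σ (ι (f l)) (ι w)
            ≡⟨ ι-glue σ (f l) w ⟨
          ι (glue σ (f l) w)
            ≡⟨ cong ι (trans (cong f (strictlyInverseˡ k)) fk≡) ⟨
          ι (f (to x)) ∎
        value : ∀ z → ⟦ Automorphism.⟦_⟧ β (gen z) ⟧ ~ ι (f (to z))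
        value z = Free.trans (⟦⟧-cong (extend-gen (freeGroup A) τ z)) (image (z ≟ x))

    tame : ∀ {m} (f : Vector (List A) m) → (∀ k → S (f k)) →
      FreelyGenerates (ι ∘ f) → IsTameFamily f
    tame f = descend f (<-wellFounded _)
      where
      descend : ∀ {m} (f : Vector (List A) m) → Acc _<_ (totalLength f) → (∀ k → S (f k)) →
        FreelyGenerates (ι ∘ f) → IsTameFamily f
      reduce-by : ∀ {m} (f : Vector (List A) m) → Acc _<_ (totalLength f) → (∀ k → S (f k)) →
        FreelyGenerates (ι ∘ f) → ∀ σ → Reducible f σ → IsTameFamily f
      reduce-by f (acc rec) f∈S fs σ (k , l , l≢k , w , eq) =
        reduct-tame⇒tame f σ l≢k eq
          (descend _ (rec (reduct-shorter f σ l≢k eq (nonempty fs l)))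
            (reduct∈S f σ l≢k eq f∈S) (reduct-freelyGenerates f σ l≢k eq fs))
      descend f ac f∈S fs with reducible? f left | reducible? f right
      ... | yes red | _       = reduce-by f ac f∈S fs left red
      ... | no _    | yes red = reduce-by f ac f∈S fs right red
      ... | no irrˡ | no irrʳ = irreducible⇒tame f f∈S fs λ { left → irrˡ ; right → irrʳ }

-- Bases of the free group as finite families

unique-lookup-injective : ∀ {A : Set a} {us : List A} → Unique us →
  ∀ {k l} → lookup us k ≡ lookup us l → k ≡ l
unique-lookup-injective (u ∷ us) {zero}  {zero}  eq = refl
unique-lookup-injective (u ∷ _) {zero}  {suc l} eq =
  contradiction eq (All.lookup u (∈-lookup l))
unique-lookup-injective (u ∷ _) {suc k} {zero}  eq =
  contradiction (sym eq) (All.lookup u (∈-lookup k))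
unique-lookup-injective (_ ∷ us) {suc k} {suc l} eq = cong suc (unique-lookup-injective us eq)

extend-map₁ : ∀ {I : Set i} {J : Set b} {A : Set a} (g : J → SignedWord A) (h : I → J) w →
  extend (freeGroup A) g (map (map₁ h) w) ≡ extend (freeGroup A) (g ∘ h) w
extend-map₁ {A = A} g h w = cong (product (freeGroup A)) (sym (map-∘ w))

-- A word without inverse letters is its own normal form.
ι-injective : ∀ {A : Set a} → DecidableEquality A → ∀ {u v : List A} → ι u ~ ι v → u ≡ v
ι-injective _≟_ {u} {v} eq = map-injective (cong proj₁)
  (trans (sym (normalise-ι u)) (trans (normalise-~ eq) (normalise-ι v)))
  where
  open NormalForm _≟_
  normalise-ι : ∀ u → normalise (ι u) ≡ ι u
  normalise-ι []          = refl
  normalise-ι (x ∷ [])    = refl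
  normalise-ι (x ∷ y ∷ u) = trans (cong ((x , pos) ▹_) (normalise-ι (y ∷ u)))
    (▹-∷ (x , pos) (ι-normal x (y ∷ u)))
    where
    ι-normal : ∀ x u → IsNormal (ι (x ∷ u))
    ι-normal x []      = [-]
    ι-normal x (y ∷ u) = (λ ()) ∷ ι-normal y u

module _ {A : Set a} (n : ℕ) (A↔Fin : A ↔ Fin n) (X : Pred (List A) q)
  (isBasis : IsFreeGroupBasis X) where

  open IsBasis isBasis
  open Inverse A↔Fin using (from; to; strictlyInverseʳ)

  _≟_ : DecidableEquality A
  _≟_ = via-injection (↔⇒↣ A↔Fin) Fin._≟_

  _≟*_ : DecidableEquality (List A)
  _≟*_ = ≡-dec _≟_

  open NormalForm _≟*_
  open DecMembership _≟*_ using (_∈?_)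

  evaluate : SignedWord (List A) → SignedWord A
  evaluate = extend (freeGroup A) ι

  -- Freeness in a basis compares factors up to `~`, normal words compare them literally;
  -- `ι-injective` reconciles the two.
  normal-trivial⇒[] : ∀ {w} → IsNormal w → All (X ∘ proj₁) w → evaluate w ~ [] → w ≡ []
  normal-trivial⇒[] {w} n ps w~[] with w | free (map (map₁ ι) w)
    (map⁺ (All.map (λ {z} p → proj₁ z , p , Free.refl) ps))
    (Linked.map⁺ (Linked.map (λ y≢x̄ (x~y , τ≡σ̄) →
      y≢x̄ (cong₂ _,_ (sym (ι-injective _≟_ x~y)) τ≡σ̄)) n))
    w~[]
  ... | [] | _ = refl

  toSignedWord : ∀ {us} → All (Image (freeGroup A) ι X ∘ proj₁) us →
    ∃ λ w → All (X ∘ proj₁) w × evaluate w ~ product (freeGroup A) us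
  toSignedWord [] = [] , [] , Free.refl
  toSignedWord {(g , σ) ∷ _} ((u , p , g~u) ∷ ps) with toSignedWord ps
  ... | w , qs , w~ = (u , σ) ∷ w , p ∷ qs ,
    Free.∙-cong (power-cong (freeGroup A) {ι u} {g} σ (Free.sym g~u)) w~

  expression : ∀ y → ∃ λ w → All (X ∘ proj₁) w × evaluate w ~ gen y
  expression y with generates (gen y)
  ... | us , ps , us~y with toSignedWord ps
  ...   | w , qs , w~ = w , qs , Free.trans w~ us~y

  wordsFor : A → List (List A)
  wordsFor y = map proj₁ (proj₁ (expression y))

  alphabet : List A
  alphabet = map from (allFin n)

  ∈-alphabet : ∀ y → y ∈ alphabet
  ∈-alphabet y = subst (_∈ alphabet) (strictlyInverseʳ y) (∈-map⁺ from (∈-allFin (to y)))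

  -- Finitely many words of `X` suffice to express the finitely many letters, hence generate.
  -- Duplicates are removed because a repeated index would be a relation.
  elements : List (List A)
  elements = deduplicate _≟*_ (concatMap wordsFor alphabet)

  elements⊆X : ∀ {u} → u ∈ elements → X u
  elements⊆X u∈
    with Any.satisfied (∈-concatMap⁻ wordsFor {xs = alphabet} (∈-deduplicate⁻ _≟*_ _ u∈))
  ... | y , u∈y = All.lookup (map⁺ (proj₁ (proj₂ (expression y)))) u∈y

  family : Vector (List A) (length elements)
  family = lookup elements

  family-injective : ∀ {k l} → family k ≡ family l → k ≡ l
  family-injective = unique-lookup-injective (deduplicate-! _≟*_ (concatMap wordsFor alphabet))

  lift : ∀ {w : SignedWord (List A)} → All ((_∈ elements) ∘ proj₁) w →
    ∃ λ w′ → map (map₁ family) w′ ≡ w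
  lift [] = [] , refl
  lift {(_ , σ) ∷ _} (u∈ ∷ ps) with lift ps
  ... | w′ , eq = (Any.index u∈ , σ) ∷ w′ , cong₂ _∷_ (cong (_, σ) (sym (lookup-index u∈))) eq

  letter : ∀ y → ∃ λ w → extend (freeGroup A) (ι ∘ family) w ~ gen y
  letter y with lift {proj₁ (expression y)} (map⁻ (All.tabulate λ u∈ →
    ∈-deduplicate⁺ _≟*_ (∈-concatMap⁺ wordsFor (lose (∈-alphabet y) u∈))))
  ... | w , eq = w , Free.trans
    (Free.reflexive (trans (sym (extend-map₁ ι family w)) (cong evaluate eq)))
    (proj₂ (proj₂ (expression y)))

  family-All : (w : SignedWord (Fin (length elements))) →
    All ((_∈ elements) ∘ proj₁) (map (map₁ family) w)
  family-All w = map⁺ (All.universal (λ z → ∈-lookup (proj₁ z)) w)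

  family-freelyGenerates : FreelyGenerates (ι ∘ family)
  family-freelyGenerates = record
    { injective  = injective
    ; surjective = λ u → extend (freeGroup _) (proj₁ ∘ letter) u ,
        Free.trans (extend-extend (freeGroup A) (ι ∘ family) (proj₁ ∘ letter) u)
          (Free.trans (extend-cong (freeGroup A) (proj₂ ∘ letter) u)
            (Free.reflexive (extend-gen-id u)))
    }
    where
    module Index = NormalForm (Fin._≟_ {length elements})
    map-normal : ∀ {w} → Index.IsNormal w → IsNormal (map (map₁ family) w)
    map-normal []        = []
    map-normal [-]       = [-]
    map-normal (z≢ȳ ∷ n) = (λ eq →
      z≢ȳ (cong₂ _,_ (family-injective (cong proj₁ eq)) (cong proj₂ eq))) ∷ map-normal n
    injective : ∀ w → extend (freeGroup A) (ι ∘ family) w ~ [] → w ~ []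
    injective w w~[] = Free.trans (Free.sym (Index.normalise~ w))
      (Free.reflexive (map≡[] (normal-trivial⇒[]
        (map-normal (Index.normalise-isNormal w))
        (All.map elements⊆X (family-All (Index.normalise w)))
        (Free.trans (Free.reflexive (extend-map₁ ι family (Index.normalise w)))
          (Free.trans (extend-~ (freeGroup A) (ι ∘ family) (Index.normalise~ w)) w~[])))))
      where
      map≡[] : ∀ {w} → map (map₁ family) w ≡ [] → w ≡ []
      map≡[] {[]} _ = refl

  -- A word `u` of `X` outside the list would equal a normal product of listed words. Multiplying it
  -- by the inverse of `u` gives a trivial nonempty product that is still normal, as `u` does not
  -- occur in it, against freeness.
  X⊆elements : ∀ {u} → X u → u ∈ elements
  X⊆elements {u} p with u ∈? elements
  ... | yes u∈ = u∈
  ... | no  u∉ with FreelyGenerates.surjective family-freelyGenerates (ι u)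
  ...   | w , w~u = contradiction
    (normal-trivial⇒[] (cons-normal (normalise-isNormal w′) w″∈)
      (p ∷ All.map elements⊆X w″∈)
      (Free.trans (Free.∙-congˡ {x = invert (ι u)}
        (Free.trans (extend-~ (freeGroup A) ι {normalise w′} {w′} (normalise~ w′))
          (Free.trans (Free.reflexive (extend-map₁ ι family w)) w~u)))
        (Free.inverseˡ (ι u))))
    λ ()
    where
    w′ : SignedWord (List A)
    w′ = map (map₁ family) w
    w″∈ : All ((_∈ elements) ∘ proj₁) (normalise w′)
    w″∈ = normalise-All {w = w′} (family-All w)
    cons-normal : ∀ {v} → IsNormal v → All ((_∈ elements) ∘ proj₁) v →
      IsNormal ((u , neg) ∷ v)
    cons-normal []          _        = [-]
    cons-normal n@[-]       (v∈ ∷ _) = (λ { refl → u∉ v∈ }) ∷ n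
    cons-normal n@(_ ∷ _)   (v∈ ∷ _) = (λ { refl → u∉ v∈ }) ∷ n

  module _ (S : Pred (List A) s) (factorial : Factorial S)
    (acyclic : ∀ {w} → S w → ¬ Cycle (extensionGraph S w)) (X⊆S : X ⊆ S) where

    open Descent _≟_

    basis-isTame : IsTame X
    basis-isTame with tame S factorial acyclic family
      (λ k → X⊆S (elements⊆X (∈-lookup k))) family-freelyGenerates
    ... | e , α , α-tame , α-gen = α , (positive , α-tame) , X⊆αA , αA⊆X
      where
      open Inverse e using () renaming (to to toᵉ; from to fromᵉ; strictlyInverseˡ to inverseᵉ)
      positive : Positive α
      positive y = family (toᵉ y) , nonempty family-freelyGenerates (toᵉ y) , α-gen y
      X⊆αA : Image (freeGroup A) ι X ⊆ Image (freeGroup A) (Automorphism.⟦_⟧ α ∘ gen) U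
      X⊆αA (u , p , g~u) = fromᵉ k , _ , Free.trans g~u (Free.trans
        (Free.reflexive (cong ι (trans (lookup-index u∈) (cong family (sym (inverseᵉ k))))))
        (Free.sym (α-gen (fromᵉ k))))
        where
        u∈ = X⊆elements p
        k = Any.index u∈
      αA⊆X : Image (freeGroup A) (Automorphism.⟦_⟧ α ∘ gen) U ⊆ Image (freeGroup A) ι X
      αA⊆X (y , _ , g~αy) =
        family (toᵉ y) , elements⊆X (∈-lookup (toᵉ y)) , Free.trans g~αy (α-gen y)

theorem5p19 : ∀ {a s x : Level} {A : Set a} (n : ℕ) → A ↔ Fin (suc n) →
    (S : Pred (List A) s) → IsUniformlyRecurrent S → IsTreeSet S →
    (X : Pred (List A) x) → IsFreeGroupBasis X → X ⊆ S → IsTame X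
theorem5p19 n A↔Fin S _ treeSet X isBasis =
  basis-isTame (suc n) A↔Fin X isBasis S factorial (proj₂ ∘ tree)
  where open IsTreeSet treeSet
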